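{- Let $A'$ be the adjacency matrix of the Grassmann graph $\Gamma'$ on the $2$-dimensional subspaces of $V=\mathbb F_q^n$, where $n\ge4$ and $q=p^t$. Then the Sylow $p$-subgroup of the Smith group $S(\Gamma')$ is cyclic of order $p^t$.
   Context: Let $p$ be a prime, $q=p^t$ with $t\ge1$, $n\ge4$, and $V$ an $n$-dimensional vector space over $\mathbb F_q$. The Grassmann graph $\Gamma'$ has as vertices the $2$-dimensional subspaces of $V$, two distinct ones being adjacent when their intersection is nonzero; $A'$ is its adjacency matrix. The Smith group $S(\Gamma')$ is the cokernel of $A'$ viewed as an endomorphism of the free abelian group on the vertices ($A'$ is invertible over $\mathbb Q$, so this group is finite). -}

module Defs where

open import Algebra.Apartness.Bundles using (HeytingCommutativeRing; HeytingField)
open import Algebra.Bundles using (AbelianGroup; CommutativeRing; Group)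
import Algebra.Construct.Pointwise as Pointwise
import Algebra.Definitions.RawMonoid as RawMonoidDefs
open import Algebra.Module.Bundles using (Module)
open import Algebra.Morphism.Structures using (IsGroupHomomorphism)
import Algebra.Properties.AbelianGroup as AbelianGroupProperties
import Algebra.Properties.CommutativeMonoid.Sum as SumProperties
import Algebra.Properties.Group as GroupProperties
import Algebra.Properties.Semiring.Sum as SemiringSum
open import Data.Bool.Base using (if_then_else_)
open import Data.Fin.Base using (Fin; zero; suc; finToFun; funToFin)
import Data.Fin.Properties as Fin
open import Data.Integer.Base as ℤ using (ℤ; +_; -[1+_]; 0ℤ; 1ℤ)
import Data.Integer.Properties as ℤ
open import Data.List.Base as List using (List)
open import Data.List.Membership.Propositional.Properties using (∈-lookup)
import Data.List.Relation.Unary.All as All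
open import Data.List.Relation.Unary.AllPairs using (_∷_)
import Data.List.Relation.Unary.Any as Any
import Data.List.Relation.Unary.Any.Properties as Any
open import Data.List.Relation.Unary.Enumerates.Setoid using (IsEnumeration)
import Data.List.Relation.Unary.Enumerates.Setoid.Properties as Enumerates
import Data.List.Relation.Unary.Unique.DecSetoid.Properties as Unique
import Data.List.Relation.Unary.Unique.Setoid as Unique
open import Data.Maybe.Base using (Maybe; just; nothing)
import Data.Maybe.Relation.Unary.Any as Maybe
open import Data.Nat.Base using (ℕ; zero; suc; _^_)
open import Data.Product.Base using (∃; ∃-syntax; _×_; _,_; proj₁; proj₂)
open import Function.Base using (id)
open import Function.Bundles using (Inverse)
open import Level as Level using (Level; _⊔_; 0ℓ)
open import Relation.Binary.Bundles using (DecSetoid; Setoid)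
import Relation.Binary.Construct.On as On
open import Relation.Binary.Core using (Rel)
open import Relation.Binary.Definitions using (Decidable; Irreflexive; Symmetric; _Respects₂_)
import Relation.Binary.PropositionalEquality as ≡
open ≡ using (_≡_)
open import Relation.Nullary.Decidable using (Dec; yes; no; does; map′; ¬?; _×-dec_; _→-dec_)
open import Relation.Nullary.Negation using (¬_; contradiction)
open import Relation.Unary using (Pred; _∈_; _⊆_; _≐_; U)

HasCardinality : ∀ {a ℓ} → Setoid a ℓ → ℕ → Set (a ⊔ ℓ)
HasCardinality S k = Inverse S (≡.setoid (Fin k))

-- Over a finite field the apartness of a `HeytingField` is forced to be the
-- negation of ≈, so it carries no extra information.
fieldRing : ∀ {c ℓ₁ ℓ₂} → HeytingField c ℓ₁ ℓ₂ → CommutativeRing c ℓ₁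
fieldRing F = HeytingCommutativeRing.commutativeRing (HeytingField.heytingCommutativeRing F)

VectorSpace : ∀ {c ℓ₁ ℓ₂} → HeytingField c ℓ₁ ℓ₂ → (m ℓm : Level) →
              Set (c ⊔ ℓ₁ ⊔ Level.suc (m ⊔ ℓm))
VectorSpace F = Module (fieldRing F)

module LinearAlgebra {c ℓ₁ ℓ₂ m ℓm} (F : HeytingField c ℓ₁ ℓ₂) (V : VectorSpace F m ℓm) where

  open HeytingField F using (Carrier; _≈_; 0#)
  open Module V using (Carrierᴹ; _≈ᴹ_; _+ᴹ_; _*ₗ_; 0ᴹ; +ᴹ-rawMonoid)
  open RawMonoidDefs +ᴹ-rawMonoid using (sum)

  linearCombination : ∀ {k} → (Fin k → Carrier) → (Fin k → Carrierᴹ) → Carrierᴹ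
  linearCombination a b = sum (λ i → a i *ₗ b i)

  LinearlyIndependent : ∀ {k} → (Fin k → Carrierᴹ) → Set (c ⊔ ℓ₁ ⊔ ℓm)
  LinearlyIndependent b = ∀ a → linearCombination a b ≈ᴹ 0ᴹ → ∀ i → a i ≈ 0#

  Span : ∀ {k} → (Fin k → Carrierᴹ) → Pred Carrierᴹ (c ⊔ ℓm)
  Span b x = ∃[ a ] x ≈ᴹ linearCombination a b

  record IsSubspace {ℓ} (P : Pred Carrierᴹ ℓ) : Set (c ⊔ m ⊔ ℓm ⊔ ℓ) where
    field
      resp      : ∀ {x y} → x ≈ᴹ y → x ∈ P → y ∈ P
      0-closed  : 0ᴹ ∈ P
      +-closed  : ∀ {x y} → x ∈ P → y ∈ P → x +ᴹ y ∈ P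
      *ₗ-closed : ∀ a {x} → x ∈ P → a *ₗ x ∈ P

  record IsBasis {ℓ k} (P : Pred Carrierᴹ ℓ) (b : Fin k → Carrierᴹ) :
                 Set (c ⊔ ℓ₁ ⊔ m ⊔ ℓm ⊔ ℓ) where
    field
      elements    : ∀ i → b i ∈ P
      independent : LinearlyIndependent b
      spanning    : P ⊆ Span b

  HasDimension : ∀ {ℓ} → Pred Carrierᴹ ℓ → ℕ → Set (c ⊔ ℓ₁ ⊔ m ⊔ ℓm ⊔ ℓ)
  HasDimension P k = ∃[ b ] IsBasis {k = k} P b

  -- The level c ⊔ ℓm is that of spans; every subspace having a finite basis is
  -- ≐ to one at this level.
  record SubspaceOfDimension (k : ℕ) : Set (Level.suc (c ⊔ ℓm) ⊔ ℓ₁ ⊔ m) where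
    field
      member       : Pred Carrierᴹ (c ⊔ ℓm)
      isSubspace   : IsSubspace member
      hasDimension : HasDimension member k

  open SubspaceOfDimension using (member)

  subspaceSetoid : ℕ → Setoid (Level.suc (c ⊔ ℓm) ⊔ ℓ₁ ⊔ m) (c ⊔ m ⊔ ℓm)
  subspaceSetoid k = record
    { Carrier       = SubspaceOfDimension k
    ; _≈_           = λ S T → member S ≐ member T
    ; isEquivalence = record
      { refl  = id , id
      ; sym   = λ (f , g) → g , f
      ; trans = λ (f , g) (f′ , g′) → (λ x → f′ (f x)) , (λ x → g (g′ x))
      }
    }

  MeetNontrivially : ∀ {k l} → SubspaceOfDimension k → SubspaceOfDimension l →
                     Set (c ⊔ m ⊔ ℓm)
  MeetNontrivially S T = ∃[ x ] x ∈ member S × x ∈ member T × ¬ (x ≈ᴹ 0ᴹ)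

record FiniteGraph v ℓ e : Set (Level.suc (v ⊔ ℓ ⊔ e)) where
  field
    vertices : Setoid v ℓ

  open Setoid vertices public using () renaming (Carrier to Vertex; _≈_ to _≈ⱽ_)

  field
    _~_         : Rel Vertex e
    ~-resp-≈    : _~_ Respects₂ _≈ⱽ_
    ~-sym       : Symmetric _~_
    ~-irrefl    : Irreflexive _≈ⱽ_ _~_
    _~?_        : Decidable _~_
    order       : ℕ
    enumeration : HasCardinality vertices order

  vertex : Fin order → Vertex
  vertex = Inverse.from enumeration

  adjacencyMatrix : Fin order → Fin order → ℤ
  adjacencyMatrix i j = if does (vertex i ~? vertex j) then 1ℤ else 0ℤ

cokernel : ∀ {a ℓ₁ b ℓ₂} (G : AbelianGroup a ℓ₁) (H : AbelianGroup b ℓ₂) →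
           let module G = AbelianGroup G; module H = AbelianGroup H in
           (f : G.Carrier → H.Carrier) →
           IsGroupHomomorphism G.rawGroup H.rawGroup f →
           AbelianGroup b (a ⊔ ℓ₂)
cokernel G H f f-homo = record
  { Carrier        = Carrier
  ; _≈_            = λ x y → ∃[ z ] x - y ≈ f z
  ; _∙_            = _∙_
  ; ε              = ε
  ; _⁻¹            = _⁻¹
  ; isAbelianGroup = record
    { isGroup = record
      { isMonoid = record
        { isSemigroup = record
          { isMagma = record
            { isEquivalence = record
              { refl  = lift refl
              ; sym   = λ {x} {y} (z , x-y≈fz) → z G.⁻¹ , (begin
                  y - x        ≈⟨ ⁻¹-anti-homo‿- x y ⟨
                  (x - y) ⁻¹   ≈⟨ ⁻¹-cong x-y≈fz ⟩
                  f z ⁻¹       ≈⟨ ⁻¹-homo z ⟨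
                  f (z G.⁻¹)   ∎)
              ; trans = λ {x} {y} {w} (z , p) (z′ , q) → z G.∙ z′ , (begin
                  x - w                ≈⟨ ∙-congʳ (identityʳ x) ⟨
                  (x ∙ ε) - w          ≈⟨ ∙-congʳ (∙-congˡ (inverseˡ y)) ⟨
                  (x ∙ (y ⁻¹ ∙ y)) - w ≈⟨ ∙-congʳ (assoc x _ y) ⟨
                  ((x - y) ∙ y) - w    ≈⟨ assoc _ y _ ⟩
                  (x - y) ∙ (y - w)    ≈⟨ ∙-cong p q ⟩
                  f z ∙ f z′           ≈⟨ homo z z′ ⟨
                  f (z G.∙ z′)         ∎)
              }
            ; ∙-cong = λ {x} {y} {u} {v} (z , p) (z′ , q) → z G.∙ z′ , (begin
                  (x ∙ u) - (y ∙ v)       ≈⟨ ∙-congˡ (⁻¹-∙-comm y v) ⟨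
                  (x ∙ u) ∙ (y ⁻¹ ∙ v ⁻¹) ≈⟨ interchange x u _ _ ⟩
                  (x - y) ∙ (u - v)       ≈⟨ ∙-cong p q ⟩
                  f z ∙ f z′              ≈⟨ homo z z′ ⟨
                  f (z G.∙ z′)            ∎)
            }
          ; assoc = λ x y z → lift (assoc x y z)
          }
        ; identity = (λ x → lift (identityˡ x)) , (λ x → lift (identityʳ x))
        }
      ; inverse = (λ x → lift (inverseˡ x)) , (λ x → lift (inverseʳ x))
      ; ⁻¹-cong = λ {x} {y} (z , p) → z G.⁻¹ , (begin
          x ⁻¹ - y ⁻¹   ≈⟨ ⁻¹-∙-comm x (y ⁻¹) ⟩
          (x - y) ⁻¹    ≈⟨ ⁻¹-cong p ⟩
          f z ⁻¹        ≈⟨ ⁻¹-homo z ⟨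
          f (z G.⁻¹)    ∎)
      }
    ; comm = λ x y → lift (comm x y)
    }
  }
  where
  module G = AbelianGroup G
  open AbelianGroup H
  open AbelianGroupProperties H
  open import Algebra.Properties.CommutativeSemigroup commutativeSemigroup using (interchange)
  open IsGroupHomomorphism f-homo using (homo; ε-homo; ⁻¹-homo)
  open import Relation.Binary.Reasoning.Setoid setoid

  lift : ∀ {x y} → x ≈ y → ∃[ z ] x - y ≈ f z
  lift x≈y = G.ε , trans (GroupProperties.x≈y⇒x∙y⁻¹≈ε group x≈y) (sym ε-homo)

freeAbelianGroup : ℕ → AbelianGroup 0ℓ 0ℓ
freeAbelianGroup k = Pointwise.abelianGroup (Fin k) ℤ.+-0-abelianGroup

module ℤ-Sum = SemiringSum ℤ.+-*-semiring

_·ᵐ_ : ∀ {k l} → (Fin k → Fin l → ℤ) → (Fin l → ℤ) → (Fin k → ℤ)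
(M ·ᵐ x) i = ℤ-Sum.sum (λ j → M i j ℤ.* x j)

·ᵐ-isGroupHomomorphism :
  ∀ {k l} (M : Fin k → Fin l → ℤ) →
  IsGroupHomomorphism (AbelianGroup.rawGroup (freeAbelianGroup l))
                      (AbelianGroup.rawGroup (freeAbelianGroup k)) (M ·ᵐ_)
·ᵐ-isGroupHomomorphism {k} {l} M = record
  { isMonoidHomomorphism = record
    { isMagmaHomomorphism = record
      { isRelHomomorphism = record
        { cong = λ x≗y i → ℤ-Sum.sum-cong-≗ (λ j → ≡.cong (M i j ℤ.*_) (x≗y j)) }
      ; homo = homo
      }
    ; ε-homo = ε-homo
    }
  ; ⁻¹-homo = λ x i → +-inverseʳ-unique ((M ·ᵐ x) i) _ (≡.trans
      (≡.sym (homo x _ i))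
      (≡.trans (ℤ-Sum.sum-cong-≗ (λ j → ≡.cong (M i j ℤ.*_) (ℤ.+-inverseʳ (x j)))) (ε-homo i)))
  }
  where
  open GroupProperties (AbelianGroup.group ℤ.+-0-abelianGroup) using () renaming (inverseʳ-unique to +-inverseʳ-unique)

  homo : ∀ x y i → (M ·ᵐ (λ j → x j ℤ.+ y j)) i ≡ (M ·ᵐ x) i ℤ.+ (M ·ᵐ y) i
  homo x y i = ≡.trans
    (ℤ-Sum.sum-cong-≗ (λ j → ℤ.*-distribˡ-+ (M i j) (x j) (y j)))
    (ℤ-Sum.∑-distrib-+ (λ j → M i j ℤ.* x j) (λ j → M i j ℤ.* y j))

  ε-homo : ∀ i → (M ·ᵐ (λ _ → 0ℤ)) i ≡ 0ℤ
  ε-homo i = ≡.trans (ℤ-Sum.sum-cong-≗ (λ j → ℤ.*-zeroʳ (M i j)))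
                     (ℤ-Sum.sum-replicate-zero l)

-- ℤ^V is represented as functions on the enumerated vertices, the vertex v
-- corresponding to its indicator function.
smithGroup : ∀ {v ℓ e} → FiniteGraph v ℓ e → AbelianGroup 0ℓ 0ℓ
smithGroup Γ = cokernel (freeAbelianGroup order) (freeAbelianGroup order)
                        (adjacencyMatrix ·ᵐ_) (·ᵐ-isGroupHomomorphism adjacencyMatrix)
  where open FiniteGraph Γ

module Subgroups {g ℓ} (G : Group g ℓ) where

  open Group G
  open RawMonoidDefs rawMonoid using () renaming (_×_ to _times_)

  infixr 8 _^^_ _^ᶻ_

  _^^_ : Carrier → ℕ → Carrier
  x ^^ k = k times x

  _^ᶻ_ : Carrier → ℤ → Carrier
  x ^ᶻ (+ k)    = x ^^ k
  x ^ᶻ -[1+ k ] = (x ^^ suc k) ⁻¹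

  record IsSubgroup {p} (P : Pred Carrier p) : Set (g ⊔ ℓ ⊔ p) where
    field
      resp      : ∀ {x y} → x ≈ y → x ∈ P → y ∈ P
      ε-closed  : ε ∈ P
      ∙-closed  : ∀ {x y} → x ∈ P → y ∈ P → x ∙ y ∈ P
      ⁻¹-closed : ∀ {x} → x ∈ P → x ⁻¹ ∈ P

  -- For finite P this is equivalent to |P| being a power of the prime p.
  IsPGroup : ∀ {ℓ′} → ℕ → Pred Carrier ℓ′ → Set (g ⊔ ℓ ⊔ ℓ′)
  IsPGroup p P = ∀ {x} → x ∈ P → ∃[ k ] x ^^ (p ^ k) ≈ ε

  record IsSylow {ℓ′} (p : ℕ) (P : Pred Carrier ℓ′) : Set (g ⊔ ℓ ⊔ Level.suc ℓ′) where
    field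
      isSubgroup : IsSubgroup P
      isPGroup   : IsPGroup p P
      maximal    : (Q : Pred Carrier ℓ′) → IsSubgroup Q → IsPGroup p Q → P ⊆ Q → Q ⊆ P

  IsCyclic : ∀ {ℓ′} → Pred Carrier ℓ′ → Set (g ⊔ ℓ ⊔ ℓ′)
  IsCyclic P = ∃[ x ] x ∈ P × (∀ {y} → y ∈ P → ∃[ k ] y ≈ x ^ᶻ k)

  HasOrder : ∀ {ℓ′} → Pred Carrier ℓ′ → ℕ → Set (g ⊔ ℓ ⊔ ℓ′)
  HasOrder P = HasCardinality (On.setoid {B = ∃ P} setoid proj₁)

abstract
  enumerable⇒finite : ∀ {a ℓ} (D : DecSetoid a ℓ) {xs} → IsEnumeration (DecSetoid.setoid D) xs →
           ∃[ k ] HasCardinality (DecSetoid.setoid D) k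
  enumerable⇒finite D {xs} enum = List.length ys , record
    { to        = to
    ; from      = List.lookup ys
    ; to-cong   = λ {x} {y} x≈y → lookup-injective unique _ _
                    (trans (sym (lookup∘to x)) (trans x≈y (lookup∘to y)))
    ; from-cong = λ { ≡.refl → refl }
    ; inverse   = (λ {i} {x} x≈yᵢ → lookup-injective unique _ _
                    (trans (sym (lookup∘to x)) x≈yᵢ))
                , (λ { {x} ≡.refl → sym (lookup∘to x) })
    }
    where
    open DecSetoid D
    ys : List Carrier
    ys = List.deduplicate _≟_ xs

    ∈ys : IsEnumeration setoid ys
    ∈ys = Enumerates.deduplicate⁺ D enum

    unique : Unique.Unique setoid ys
    unique = Unique.deduplicate-! D xs

    to : Carrier → Fin (List.length ys)
    to x = Any.index (∈ys x)

    lookup∘to : ∀ x → x ≈ List.lookup ys (to x)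
    lookup∘to x = Any.lookup-index (∈ys x)

    lookup-injective : ∀ {zs} → Unique.Unique setoid zs → ∀ i j →
                       List.lookup zs i ≈ List.lookup zs j → i ≡ j
    lookup-injective (_  ∷ _)  zero    zero    _   = ≡.refl
    lookup-injective (z≉ ∷ _)  zero    (suc j) z≈  = contradiction z≈ (All.lookup z≉ (∈-lookup j))
    lookup-injective (z≉ ∷ _)  (suc i) zero    ≈z  = contradiction (sym ≈z) (All.lookup z≉ (∈-lookup i))
    lookup-injective (_  ∷ zs) (suc i) (suc j) eq  = ≡.cong suc (lookup-injective zs i j eq)

module FiniteVectorSpace
  {c ℓ₁ ℓ₂ m ℓm} (F : HeytingField c ℓ₁ ℓ₂) (V : VectorSpace F m ℓm) {q n : ℕ}
  (F-card : HasCardinality (CommutativeRing.setoid (fieldRing F)) q)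
  (V-dim : LinearAlgebra.HasDimension F V U n)
  where

  open LinearAlgebra F V
  open SubspaceOfDimension
  open CommutativeRing (fieldRing F) using (Carrier; _≈_; 0#; 1#; _+_; _*_; refl; sym; trans)
  open Module V
  open SumProperties +ᴹ-commutativeMonoid using (sum; sum-cong-≋; sum-replicate-zero; ∑-distrib-+)

  private
    module F = Inverse F-card
    module B = IsBasis (proj₂ V-dim)

  coordinates : ∀ {k} → Fin (q ^ k) → Fin k → Carrier
  coordinates j i = F.from (finToFun j i)

  abstract
    coordinates-surjective : ∀ {k} (a : Fin k → Carrier) →
                             ∃[ j ] (∀ i → a i ≈ coordinates j i)
    coordinates-surjective {k} a = funToFin (λ i → F.to (a i)) , λ i → sym (F.inverseʳ
      (Fin.finToFun-funToFin (λ i → F.to (a i)) i))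

    lc-cong : ∀ {k} {a a′ : Fin k → Carrier} {b b′ : Fin k → Carrierᴹ} →
              (∀ i → a i ≈ a′ i) → (∀ i → b i ≈ᴹ b′ i) →
              linearCombination a b ≈ᴹ linearCombination a′ b′
    lc-cong a≈ b≈ = sum-cong-≋ (λ i → *ₗ-cong (a≈ i) (b≈ i))

    lc-zero : ∀ {k} (b : Fin k → Carrierᴹ) → linearCombination (λ _ → 0#) b ≈ᴹ 0ᴹ
    lc-zero {k} b = ≈ᴹ-trans (sum-cong-≋ (λ i → *ₗ-zeroˡ (b i))) (sum-replicate-zero k)

    lc-closed : ∀ {ℓ k} {P : Pred Carrierᴹ ℓ} → IsSubspace P →
                (a : Fin k → Carrier) {b : Fin k → Carrierᴹ} → (∀ i → b i ∈ P) →
                linearCombination a b ∈ P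
    lc-closed {k = zero}  P a b∈P = IsSubspace.0-closed P
    lc-closed {k = suc k} P a b∈P = IsSubspace.+-closed P
      (IsSubspace.*ₗ-closed P (a zero) (b∈P zero))
      (lc-closed P (λ i → a (suc i)) (λ i → b∈P (suc i)))

    *ₗ-distrib-sum : ∀ {k} s (x : Fin k → Carrierᴹ) →
                     s *ₗ sum x ≈ᴹ sum (λ i → s *ₗ x i)
    *ₗ-distrib-sum {zero}  s x = *ₗ-zeroʳ s
    *ₗ-distrib-sum {suc k} s x = ≈ᴹ-trans (*ₗ-distribˡ s _ _)
      (+ᴹ-congˡ (*ₗ-distrib-sum s (λ i → x (suc i))))

    span-isSubspace : ∀ {k} (b : Fin k → Carrierᴹ) → IsSubspace (Span b)
    span-isSubspace b = record
      { resp      = λ x≈y (a , x≈) → a , ≈ᴹ-trans (≈ᴹ-sym x≈y) x≈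
      ; 0-closed  = _ , ≈ᴹ-sym (lc-zero b)
      ; +-closed  = λ (a , x≈) (a′ , y≈) → (λ i → a i + a′ i) ,
          ≈ᴹ-trans (+ᴹ-cong x≈ y≈) (≈ᴹ-sym (≈ᴹ-trans
            (sum-cong-≋ (λ i → *ₗ-distribʳ (b i) (a i) (a′ i)))
            (∑-distrib-+ (λ i → a i *ₗ b i) (λ i → a′ i *ₗ b i))))
      ; *ₗ-closed = λ s (a , x≈) → (λ i → s * a i) ,
          ≈ᴹ-trans (*ₗ-congˡ x≈) (≈ᴹ-trans (*ₗ-distrib-sum s (λ i → a i *ₗ b i))
            (sum-cong-≋ (λ i → ≈ᴹ-sym (*ₗ-assoc s (a i) (b i)))))
      }

    basis⊆span : ∀ {k} (b : Fin k → Carrierᴹ) i → b i ∈ Span b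
    basis⊆span b zero    = (λ { zero → 1# ; (suc _) → 0# }) , ≈ᴹ-sym (≈ᴹ-trans
      (+ᴹ-cong (*ₗ-identityˡ _) (lc-zero (λ i → b (suc i)))) (+ᴹ-identityʳ _))
    basis⊆span b (suc i) with (a , bᵢ≈) ← basis⊆span (λ i → b (suc i)) i =
      (λ { zero → 0# ; (suc j) → a j }) ,
      ≈ᴹ-trans bᵢ≈ (≈ᴹ-sym (≈ᴹ-trans (+ᴹ-congʳ (*ₗ-zeroˡ _)) (+ᴹ-identityˡ _)))

    _≟_ : Decidable _≈_
    x ≟ y = map′ (λ eq → trans (sym (F.inverseʳ ≡.refl)) (F.inverseʳ eq))
                 F.to-cong (F.to x Fin.≟ F.to y)

    ≈0? : ∀ x → Dec (x ≈ᴹ 0ᴹ)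
    ≈0? x with (a , x≈) ← B.spanning {x} _ = map′
      (λ a≈0 → ≈ᴹ-trans x≈ (≈ᴹ-trans (lc-cong a≈0 (λ _ → ≈ᴹ-refl)) (lc-zero (proj₁ V-dim))))
      (λ x≈0 → B.independent a (≈ᴹ-trans (≈ᴹ-sym x≈) x≈0))
      (Fin.all? (λ i → a i ≟ 0#))

    _≟ᴹ_ : Decidable _≈ᴹ_
    x ≟ᴹ y = map′ (x∙y⁻¹≈ε⇒x≈y x y) x≈y⇒x∙y⁻¹≈ε (≈0? (x +ᴹ -ᴹ y))
      where open GroupProperties +ᴹ-group

  vector : Fin (q ^ n) → Carrierᴹ
  vector j = linearCombination (coordinates j) (proj₁ V-dim)

  abstract
    vector-surjective : ∀ x → ∃[ j ] x ≈ᴹ vector j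
    vector-surjective x with (a , x≈) ← B.spanning {x} _
                        with (j , a≈) ← coordinates-surjective a =
      j , ≈ᴹ-trans x≈ (lc-cong a≈ (λ _ → ≈ᴹ-refl))

    span? : ∀ {k} (b : Fin k → Carrierᴹ) x → Dec (x ∈ Span b)
    span? b x = map′
      (λ (j , x≈) → coordinates j , x≈)
      (λ (a , x≈) → let (j , a≈) = coordinates-surjective a in
        j , ≈ᴹ-trans x≈ (lc-cong a≈ (λ _ → ≈ᴹ-refl)))
      (Fin.any? (λ j → x ≟ᴹ linearCombination (coordinates j) b))

    span⊆ : ∀ {ℓ k} {P : Pred Carrierᴹ ℓ} → IsSubspace P →
            {b : Fin k → Carrierᴹ} → (∀ i → b i ∈ P) → Span b ⊆ P
    span⊆ P b∈P (a , x≈) = IsSubspace.resp P (≈ᴹ-sym x≈) (lc-closed P a b∈P)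

    member? : ∀ {k} (S : SubspaceOfDimension k) x → Dec (x ∈ member S)
    member? S x = map′ (span⊆ (isSubspace S) elements) spanning (span? _ x)
      where open IsBasis (proj₂ (hasDimension S))

    ⊆? : ∀ {k l} (S : SubspaceOfDimension k) (T : SubspaceOfDimension l) →
         Dec (member S ⊆ member T)
    ⊆? S T = map′
      (λ b∈T x∈S → span⊆ (isSubspace T) b∈T (spanning x∈S))
      (λ S⊆T i → S⊆T (elements i))
      (Fin.all? (λ i → member? T (proj₁ (hasDimension S) i)))
      where open IsBasis (proj₂ (hasDimension S))

    independent? : ∀ {k} (b : Fin k → Carrierᴹ) → Dec (LinearlyIndependent b)
    independent? b = map′
      (λ h a ≈0 → let (j , a≈) = coordinates-surjective a in λ i →
        trans (a≈ i) (h j (≈ᴹ-trans (≈ᴹ-sym (lc-cong a≈ (λ _ → ≈ᴹ-refl))) ≈0) i))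
      (λ h j → h (coordinates j))
      (Fin.all? (λ j → ≈0? (linearCombination (coordinates j) b) →-dec
                       Fin.all? (λ i → coordinates j i ≟ 0#)))

  spanned : ∀ {k} (b : Fin k → Carrierᴹ) → LinearlyIndependent b → SubspaceOfDimension k
  spanned b ind = record
    { member       = Span b
    ; isSubspace   = span-isSubspace b
    ; hasDimension = b , record
      { elements = basis⊆span b ; independent = ind ; spanning = id }
    }

  spanned? : ∀ {k} → (Fin k → Carrierᴹ) → Maybe (SubspaceOfDimension k)
  spanned? b with independent? b
  ... | yes ind = just (spanned b ind)
  ... | no  _   = nothing

  subspaceDecSetoid : ℕ → DecSetoid _ _
  subspaceDecSetoid k = record
    { isDecEquivalence = record
      { isEquivalence = Setoid.isEquivalence (subspaceSetoid k)
      ; _≟_           = λ S T → ⊆? S T ×-dec ⊆? T S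
      }
    }

  subspaces : ∀ k → List (SubspaceOfDimension k)
  subspaces k = List.mapMaybe spanned? (List.tabulate {n = (q ^ n) ^ k} (λ j i → vector (finToFun j i)))

  abstract
    subspaces-complete : ∀ k → IsEnumeration (subspaceSetoid k) (subspaces k)
    subspaces-complete k S = Any.mapMaybe⁺ spanned? _ (Any.map⁺ (Any.tabulate⁺ j found))
      where
      b : Fin k → Carrierᴹ
      b = proj₁ (hasDimension S)

      open IsBasis (proj₂ (hasDimension S))

      j : Fin ((q ^ n) ^ k)
      j = funToFin {k} (λ i → proj₁ (vector-surjective (b i)))

      b′ : Fin k → Carrierᴹ
      b′ i = vector (finToFun j i)

      b≈b′ : ∀ i → b i ≈ᴹ b′ i
      b≈b′ i = ≈ᴹ-trans (proj₂ (vector-surjective (b i)))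
        (≈ᴹ-reflexive (≡.cong vector (≡.sym (Fin.finToFun-funToFin
          (λ i → proj₁ (vector-surjective (b i))) i))))

      independent′ : LinearlyIndependent b′
      independent′ a ≈0 = independent a (≈ᴹ-trans (lc-cong (λ _ → refl) b≈b′) ≈0)

      S≐span : member S ≐ Span b′
      S≐span = (λ x∈S → let (a , x≈) = spanning x∈S in
                 a , ≈ᴹ-trans x≈ (lc-cong (λ _ → refl) b≈b′))
             , span⊆ (isSubspace S) (λ i → IsSubspace.resp (isSubspace S) (b≈b′ i) (elements i))

      found : Maybe.Any (λ T → member S ≐ member T) (spanned? b′)
      found with independent? b′
      ... | yes _   = Maybe.just S≐span
      ... | no  dep = contradiction independent′ dep

  abstract
    finitelyManySubspaces : ∀ k → ∃[ N ] HasCardinality (subspaceSetoid k) N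
    finitelyManySubspaces k = enumerable⇒finite (subspaceDecSetoid k) (subspaces-complete k)

    sameSubspace? : ∀ {k} → Decidable (Setoid._≈_ (subspaceSetoid k))
    sameSubspace? {k} = DecSetoid._≟_ (subspaceDecSetoid k)

    meetNontrivially? : ∀ {k} → Decidable (MeetNontrivially {k} {k})
    meetNontrivially? S T = map′
      (λ (j , p) → vector j , p)
      (λ (x , x∈S , x∈T , x≉0) → let (j , x≈) = vector-surjective x in
        j , IsSubspace.resp (isSubspace S) x≈ x∈S
          , IsSubspace.resp (isSubspace T) x≈ x∈T
          , λ ≈0 → x≉0 (≈ᴹ-trans x≈ ≈0))
      (Fin.any? (λ j → member? S (vector j) ×-dec member? T (vector j) ×-dec ¬? (≈0? (vector j))))

grassmannGraph :
  ∀ {c ℓ₁ ℓ₂ m ℓm} (F : HeytingField c ℓ₁ ℓ₂) (V : VectorSpace F m ℓm) {q n : ℕ} →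
  HasCardinality (CommutativeRing.setoid (fieldRing F)) q →
  LinearAlgebra.HasDimension F V U n →
  FiniteGraph (Level.suc (c ⊔ ℓm) ⊔ ℓ₁ ⊔ m) (c ⊔ m ⊔ ℓm) (c ⊔ m ⊔ ℓm)
grassmannGraph F V F-card V-dim = record
  { vertices    = subspaceSetoid 2
  ; _~_         = λ S T → ¬ (member S ≐ member T) × MeetNontrivially S T
  ; ~-resp-≈    = (λ (T⊆T′ , T′⊆T) (S≢T , x , x∈S , x∈T , x≉0) →
                    (λ (S⊆T′ , T′⊆S) → S≢T ((λ s → T′⊆T (S⊆T′ s)) , (λ t → T′⊆S (T⊆T′ t))))
                    , x , x∈S , T⊆T′ x∈T , x≉0)
                , (λ (S⊆S′ , S′⊆S) (S≢T , x , x∈S , x∈T , x≉0) →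
                    (λ (S′⊆T , T⊆S′) → S≢T ((λ s → S′⊆T (S⊆S′ s)) , (λ t → S′⊆S (T⊆S′ t))))
                    , x , S⊆S′ x∈S , x∈T , x≉0)
  ; ~-sym       = λ (S≢T , x , x∈S , x∈T , x≉0) →
                    (λ (T⊆S , S⊆T) → S≢T (S⊆T , T⊆S)) , x , x∈T , x∈S , x≉0
  ; ~-irrefl    = λ S≐T (S≢T , _) → S≢T S≐T
  ; _~?_        = λ S T → ¬? (sameSubspace? S T) ×-dec meetNontrivially? S T
  ; order       = proj₁ (finitelyManySubspaces 2)
  ; enumeration = proj₂ (finitelyManySubspaces 2)
  }
  where
  open LinearAlgebra F V
  open SubspaceOfDimension using (member)
  open FiniteVectorSpace F V F-card V-dim

{-# OPTIONS --safe #-}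

-- Write A for the adjacency matrix, w = q + 1, and 1 + c for the number of lines
-- of PG(V) through a point, so that q divides c.  Double counting with the incidence
-- matrix of lines against nonzero vectors gives A² + (2 w - c) A + w (w - c) I = w² J,
-- with A regular of degree w c = q u, where u, w (w - c) and the number of lines are
-- all 1 modulo p.  Hence in the cokernel w (w - c) [x] = w² σ(x) [1], with σ the
-- coordinate sum.  Since A has column sums q u, σ is well defined modulo q; on the
-- p-primary part it is injective because q u [1] = 0, and surjective because u [1]
-- lies there and its coordinate sum is prime to p.

module Submission where

open import Algebra.Apartness.Bundles using (HeytingField)
open import Algebra.Bundles using (AbelianGroup; CommutativeRing)
open import Algebra.Module.Bundles using (Module)
import Algebra.Properties.CommutativeMonoid.Sum as SumProperties
import Algebra.Properties.Group as GroupProperties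
open import Data.Bool.Base using (if_then_else_)
open import Data.Fin.Base using (Fin; zero; suc; toℕ; fromℕ<; funToFin; combine)
import Data.Fin.Properties as Fin
open import Data.Integer.Base as ℤ using (ℤ; +_; -[1+_]; 0ℤ; 1ℤ; _+_; _*_; _-_; -_; NonZero)
open import Data.Integer.DivMod using (_%ℕ_; _/ℕ_; n%ℕd<d; a≡a%ℕn+[a/ℕn]*n)
import Data.Integer.Properties as ℤ
open import Data.Integer.Tactic.RingSolver using (solve-∀)
open import Data.Nat.Base as ℕ using (ℕ; zero; suc; _≤_; _^_)
import Data.Nat.DivMod as ℕ
open import Data.Nat.Primality using (Prime; prime⇒nonZero; prime⇒nonTrivial)
import Data.Nat.Properties as ℕ
open import Data.Product.Base using (∃; ∃-syntax; _×_; _,_; proj₁; proj₂)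
open import Function.Base using (_∘_; id)
open import Function.Bundles using (Inverse)
open import Level using (Level; 0ℓ)
open import Relation.Binary.PropositionalEquality using (_≡_; _≢_; _≗_; refl; sym; trans; cong; cong₂; subst; module ≡-Reasoning)
open import Relation.Nullary.Decidable using (Dec; yes; no; does; _×-dec_; ¬?)
open import Relation.Nullary.Negation using (¬_; contradiction)
open import Relation.Unary using (Pred; _⊆_; _≐_; _∈_; _∉_; U)
open import Defs
open ℤ-Sum using (sum; sum-cong-≗; ∑-distrib-+; ∑-comm; *-distribˡ-sum; *-distribʳ-sum; sum-replicate-zero)
open GroupProperties (AbelianGroup.group ℤ.+-0-abelianGroup) using () renaming (∙-cancelˡ to +-cancelˡ)

-- Over the integers localised at p the number of lines is a unit, so ℤ^V splits into the constants
-- and the vectors of coordinate sum 0. On the latter A (A + γ) = - D with D a unit, so A is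
-- invertible there and contributes nothing to the p-part; on the constants A is multiplication by q
-- u with u a unit, which leaves ℤ/q. The proof carries this out without localising: each inversion
-- of a unit is an explicit identity a e + p^j f = 1. The quadratic relation comes from the
-- incidence matrix N: N Nᵀ = (q - 1) (A + w I), while on nonzero vectors Nᵀ N is constant apart
-- from the pairs of proportional vectors. Indexing N by vectors rather than by projective points
-- avoids a quotient of V; the price is factors q - 1, which are cancelled at the end.

private variable
  ℓ ℓ′ : Level
  k n : ℕ

-- Finite sums and indicators

𝟙 : {P : Set ℓ} → Dec P → ℤ
𝟙 d = if does d then 1ℤ else 0ℤ

sum-const : ∀ n a → sum {n} (λ _ → a) ≡ + n * a
sum-const zero    a = refl
sum-const (suc n) a = trans (cong (_+_ a) (sum-const n a)) (sym (ℤ.suc-* (+ n) a))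

sum-single : (f : Fin n → ℤ) (i : Fin n) → (∀ j → j ≢ i → f j ≡ 0ℤ) → sum f ≡ f i
sum-single {suc n} f zero    h = trans
  (cong (_+_ (f zero)) (trans (sum-cong-≗ (λ j → h (suc j) λ ())) (sum-replicate-zero n)))
  (ℤ.+-identityʳ (f zero))
sum-single {suc n} f (suc i) h = trans
  (cong₂ _+_ (h zero λ ()) (sum-single (f ∘ suc) i (λ j j≢i → h (suc j) (j≢i ∘ Fin.suc-injective))))
  (ℤ.+-identityˡ (f (suc i)))

sum-sub : ∀ (x y : Fin n → ℤ) → sum (λ i → x i - y i) ≡ sum x - sum y
sum-sub x y = trans (∑-distrib-+ x (λ i → - y i)) (cong (_+_ (sum x))
  (trans (sum-cong-≗ (λ i → sym (ℤ.-1*i≡-i (y i)))) (trans (sym (*-distribˡ-sum (- 1ℤ) y)) (ℤ.-1*i≡-i (sum y)))))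

sum-*-sum : ∀ {k n} (x : Fin k → ℤ) (y : Fin n → ℤ) → sum x * sum y ≡ sum (λ i → sum (λ j → x i * y j))
sum-*-sum x y = trans (*-distribʳ-sum (sum y) x) (sum-cong-≗ (λ i → *-distribˡ-sum (x i) y))

𝟙-yes : {P : Set ℓ} (d : Dec P) → P → 𝟙 d ≡ 1ℤ
𝟙-yes (yes _) _ = refl
𝟙-yes (no ¬p) p = contradiction p ¬p

𝟙-no : {P : Set ℓ} (d : Dec P) → ¬ P → 𝟙 d ≡ 0ℤ
𝟙-no (yes p) ¬p = contradiction p ¬p
𝟙-no (no _)  _  = refl

sum-δ : (x : Fin n → ℤ) (i : Fin n) → sum (λ k → 𝟙 (i Fin.≟ k) * x k) ≡ x i
sum-δ x i = trans
  (sum-single _ i (λ j j≢i → trans (cong (_* x j) (𝟙-no (i Fin.≟ j) (j≢i ∘ sym))) (ℤ.*-zeroˡ (x j))))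
  (trans (cong (_* x i) (𝟙-yes (i Fin.≟ i) refl)) (ℤ.*-identityˡ (x i)))

𝟙-⇔ : {P : Set ℓ} {Q : Set ℓ′} (d : Dec P) (e : Dec Q) → (P → Q) → (Q → P) → 𝟙 d ≡ 𝟙 e
𝟙-⇔ (yes p) e f g = sym (𝟙-yes e (f p))
𝟙-⇔ (no ¬p) e f g = sym (𝟙-no e (¬p ∘ g))

𝟙-× : {P : Set ℓ} {Q : Set ℓ′} (d : Dec P) (e : Dec Q) → 𝟙 (d ×-dec e) ≡ 𝟙 d * 𝟙 e
𝟙-× (yes _) (yes _) = refl
𝟙-× (yes _) (no _)  = refl
𝟙-× (no _)  (yes _) = refl
𝟙-× (no _)  (no _)  = refl

𝟙-idem : {P : Set ℓ} (d : Dec P) → 𝟙 d * 𝟙 d ≡ 𝟙 d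
𝟙-idem (yes _) = refl
𝟙-idem (no _)  = refl

count-unique : {P : Fin n → Set ℓ} (P? : ∀ j → Dec (P j)) (i : Fin n) →
               P i → (∀ j → P j → j ≡ i) → sum (λ j → 𝟙 (P? j)) ≡ 1ℤ
count-unique P? i p unique = trans
  (sum-single _ i (λ j j≢i → 𝟙-no (P? j) (λ p′ → j≢i (unique j p′))))
  (𝟙-yes (P? i) p)

count-mono : {P : Fin n → Set ℓ} {Q : Fin n → Set ℓ′} (P? : ∀ j → Dec (P j)) (Q? : ∀ j → Dec (Q j)) →
             (∀ j → P j → Q j) → sum (λ j → 𝟙 (P? j)) ℤ.≤ sum (λ j → 𝟙 (Q? j))
count-mono {zero}  P? Q? P⊆Q = ℤ.≤-refl
count-mono {suc n} P? Q? P⊆Q = ℤ.+-mono-≤ head (count-mono (P? ∘ suc) (Q? ∘ suc) (λ j → P⊆Q (suc j)))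
  where
  head : 𝟙 (P? zero) ℤ.≤ 𝟙 (Q? zero)
  head with P? zero | Q? zero
  ... | yes _ | yes _ = ℤ.≤-refl
  ... | yes p | no ¬q = contradiction (P⊆Q zero p) ¬q
  ... | no _  | yes _ = ℤ.+≤+ ℕ.z≤n
  ... | no _  | no _  = ℤ.≤-refl

-- If the head lay in `Q` but not in `P`, the tail of `P` would outnumber the tail of `Q`, against
-- `count-mono`. This lets counting stand in for dimension arguments.
count-≡⇒⊇ : {P : Fin n → Set ℓ} {Q : Fin n → Set ℓ′} (P? : ∀ j → Dec (P j)) (Q? : ∀ j → Dec (Q j)) →
            (∀ j → P j → Q j) → sum (λ j → 𝟙 (P? j)) ≡ sum (λ j → 𝟙 (Q? j)) → ∀ j → Q j → P j
count-≡⇒⊇ {suc n} P? Q? P⊆Q eq j q with P? zero | Q? zero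
... | yes p | no ¬q = contradiction (P⊆Q zero p) ¬q
... | no _  | yes _ = contradiction
  (subst (ℤ._≤ sum (λ j → 𝟙 (Q? (suc j)))) (trans (sym (ℤ.+-identityˡ _)) eq)
    (count-mono (P? ∘ suc) (Q? ∘ suc) (λ j → P⊆Q (suc j))))
  (ℤ.<⇒≱ (ℤ.suc[i]≤j⇒i<j ℤ.≤-refl))
count-≡⇒⊇ P? Q? P⊆Q eq zero    q | yes p | yes _ = p
count-≡⇒⊇ P? Q? P⊆Q eq zero    q | no _  | no ¬q = contradiction q ¬q
count-≡⇒⊇ P? Q? P⊆Q eq (suc j) q | yes p | yes _ = count-≡⇒⊇ (P? ∘ suc) (Q? ∘ suc)
  (λ j → P⊆Q (suc j)) (+-cancelˡ 1ℤ _ _ eq) j q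
count-≡⇒⊇ P? Q? P⊆Q eq (suc j) q | no _  | no ¬q = count-≡⇒⊇ (P? ∘ suc) (Q? ∘ suc)
  (λ j → P⊆Q (suc j)) (+-cancelˡ 0ℤ _ _ eq) j q

-- Congruences modulo p

infix 4 _≡1[mod_]

record _≡1[mod_] (a : ℤ) (p : ℕ) : Set where
  constructor mk
  field
    quotient : ℤ
    equality : a ≡ 1ℤ + + p * quotient

≡1-* : ∀ {a b p} → a ≡1[mod p ] → b ≡1[mod p ] → a * b ≡1[mod p ]
≡1-* {p = p} (mk d refl) (mk e refl) = mk _ (expand (+ p) d e)
  where
  expand : ∀ r d e → (1ℤ + r * d) * (1ℤ + r * e) ≡ 1ℤ + r * (d + e + r * d * e)
  expand = solve-∀

-- Induction lifts an inverse of a from modulus p^j to p^(j+1): if a = 1 + p d and a e + p^j f = 1,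
-- then a (e + p^j f) = 1 + p^(j+1) d f.
bezout : ∀ {a p} → a ≡1[mod p ] → ∀ j → ∃[ e ] ∃[ f ] a * e + + (p ^ j) * f ≡ 1ℤ
bezout {a} h zero = 0ℤ , 1ℤ , base a
  where
  base : ∀ a → a * 0ℤ + 1ℤ * 1ℤ ≡ 1ℤ
  base = solve-∀
bezout {p = p} h@(mk d refl) (suc j) with e , f , eq ← bezout h j =
  e + + (p ^ j) * f , - (d * f) , (begin
    (1ℤ + + p * d) * (e + + (p ^ j) * f) + + (p ^ suc j) * (- (d * f))
      ≡⟨ cong (λ s → (1ℤ + + p * d) * (e + + (p ^ j) * f) + s * (- (d * f))) (ℤ.pos-* p (p ^ j)) ⟩
    (1ℤ + + p * d) * (e + + (p ^ j) * f) + (+ p * + (p ^ j)) * (- (d * f))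
      ≡⟨ regroup (+ p) d e (+ (p ^ j)) f ⟩
    (1ℤ + + p * d) * e + + (p ^ j) * f
      ≡⟨ eq ⟩
    1ℤ ∎)
  where
  open ≡-Reasoning
  regroup : ∀ r d e s f → (1ℤ + r * d) * (e + s * f) + (r * s) * (- (d * f)) ≡ (1ℤ + r * d) * e + s * f
  regroup = solve-∀

remainder-unique : ∀ {q r s} → r ℕ.< q → s ℕ.< q → ∀ m → + r ≡ + s + m * + q → r ≡ s
remainder-unique {q} {r} {s} r<q s<q (+ zero) eq = ℤ.+-injective (trans eq (ℤ.+-identityʳ (+ s)))
remainder-unique {q} {r} {s} r<q s<q (+ suc m) eq = contradiction r<q (ℕ.≤⇒≯ (subst (q ℕ.≤_) (sym r≡)
    (ℕ.≤-trans (ℕ.m≤m+n q (m ℕ.* q)) (ℕ.m≤n+m _ s))))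
  where
  r≡ : r ≡ s ℕ.+ suc m ℕ.* q
  r≡ = ℤ.+-injective (trans eq (trans (cong (λ z → + s + z) (sym (ℤ.pos-* (suc m) q))) (sym (ℤ.pos-+ s _))))
-- A negative multiple moves to the other side, which exchanges r and s.
remainder-unique {q} {r} {s} r<q s<q -[1+ m ] eq = sym (remainder-unique s<q r<q (+ suc m)
  (trans (swap (+ s) (+ suc m) (+ q)) (cong (_+ + suc m * + q) (sym eq))))
  where
  swap : ∀ s m q → s ≡ (s + (- m) * q) + m * q
  swap = solve-∀

%ℕ-cong : ∀ {a b} q .{{_ : ℕ.NonZero q}} m → a ≡ b + m * + q → a %ℕ q ≡ b %ℕ q
%ℕ-cong {a} {b} q m eq = remainder-unique (n%ℕd<d a q) (n%ℕd<d b q) (m + b /ℕ q - a /ℕ q)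
  (move (+ (a %ℕ q)) (+ (b %ℕ q)) (a /ℕ q) (b /ℕ q) m (+ q)
    (trans (sym (a≡a%ℕn+[a/ℕn]*n a q)) (trans eq (cong (_+ m * + q) (a≡a%ℕn+[a/ℕn]*n b q)))))
  where
  regroup₁ : ∀ r a q → r ≡ (r + a * q) - a * q
  regroup₁ = solve-∀
  regroup₂ : ∀ s a b m q → (s + b * q + m * q) - a * q ≡ s + (m + b - a) * q
  regroup₂ = solve-∀
  move : ∀ r s a b m q → r + a * q ≡ s + b * q + m * q → r ≡ s + (m + b - a) * q
  move r s a b m q h = trans (regroup₁ r a q) (trans (cong (_- a * q) h) (regroup₂ s a b m q))

-- The q-integer 1 + q + ... + q^(k-1); for a prime power q it counts the points of PG(k - 1, q).
-- The Horner form displays it as 1 modulo q for positive k.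
geometric : ℤ → ℕ → ℤ
geometric q zero    = 0ℤ
geometric q (suc k) = 1ℤ + q * geometric q k

pow-geometric : ∀ q k → + (q ^ k) ≡ 1ℤ + (+ q - 1ℤ) * geometric (+ q) k
pow-geometric q zero    = sym (trans (cong (_+_ 1ℤ) (ℤ.*-zeroʳ (+ q - 1ℤ))) (ℤ.+-identityʳ 1ℤ))
pow-geometric q (suc k) = trans (ℤ.pos-* q (q ^ k))
  (trans (cong (+ q *_) (pow-geometric q k)) (step (+ q) (geometric (+ q) k)))
  where
  step : ∀ q g → q * (1ℤ + (q - 1ℤ) * g) ≡ 1ℤ + (q - 1ℤ) * (1ℤ + q * g)
  step = solve-∀

nonZero-pred : ∀ {k} → 2 ≤ k → NonZero (+ k - 1ℤ)
nonZero-pred (ℕ.s≤s (ℕ.s≤s _)) = _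

-- Sylow subgroups of a matrix cokernel

matrixCokernel : (Fin n → Fin n → ℤ) → AbelianGroup 0ℓ 0ℓ
matrixCokernel {n} A = cokernel (freeAbelianGroup n) (freeAbelianGroup n) (A ·ᵐ_) (·ᵐ-isGroupHomomorphism A)

module _ (A : Fin n → Fin n → ℤ) where

  open AbelianGroup (matrixCokernel A) using (_≈_; ε; group)
  open Subgroups group

  -- `x ≈ y` in the cokernel unfolds to `InImage` of the pointwise difference, so the closure lemmas
  -- below compute with classes as integer vectors.
  InImage : (Fin n → ℤ) → Set
  InImage x = ∃[ z ] ∀ i → x i ≡ (A ·ᵐ z) i

  scale-image : ∀ {x} c → InImage x → InImage (λ i → c * x i)
  scale-image {x} c (z , eq) = (λ j → c * z j) , λ i → begin
    c * x i                       ≡⟨ cong (c *_) (eq i) ⟩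
    c * sum (λ j → A i j * z j)   ≡⟨ *-distribˡ-sum c (λ j → A i j * z j) ⟩
    sum (λ j → c * (A i j * z j)) ≡⟨ sum-cong-≗ (λ j → swap c (A i j) (z j)) ⟩
    sum (λ j → A i j * (c * z j)) ∎
    where
    open ≡-Reasoning
    swap : ∀ c a z → c * (a * z) ≡ a * (c * z)
    swap = solve-∀

  add-image : ∀ {x y} → InImage x → InImage y → InImage (λ i → x i + y i)
  add-image (z , eq) (w , eq′) = (λ j → z j + w j) , λ i → trans (cong₂ _+_ (eq i) (eq′ i)) (trans
    (sym (∑-distrib-+ (λ j → A i j * z j) (λ j → A i j * w j)))
    (sum-cong-≗ (λ j → sym (ℤ.*-distribˡ-+ (A i j) (z j) (w j)))))

  resp-image : ∀ {x y} → (∀ i → x i ≡ y i) → InImage x → InImage y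
  resp-image eq (z , h) = z , λ i → trans (sym (eq i)) (h i)

  ^^-pointwise : ∀ x k i → (x ^^ k) i ≡ + k * x i
  ^^-pointwise x zero    i = refl
  ^^-pointwise x (suc k) i = trans (cong (_+_ (x i)) (^^-pointwise x k i)) (sym (ℤ.suc-* (+ k) (x i)))

  ^ᶻ-pointwise : ∀ x k i → (x ^ᶻ k) i ≡ k * x i
  ^ᶻ-pointwise x (+ k)    i = ^^-pointwise x k i
  ^ᶻ-pointwise x -[1+ k ] i = trans (cong -_ (^^-pointwise x (suc k) i)) (ℤ.neg-distribˡ-* (+ suc k) (x i))

  -- The multiple is spelled out coordinatewise instead of through `^^`, so that ring identities
  -- apply. The level `0ℓ` is the one over which Sylow maximality quantifies in the theorem.
  Torsion : ℕ → Pred (Fin n → ℤ) 0ℓ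
  Torsion p x = ∃[ j ] InImage (λ i → + (p ^ j) * x i)

  torsion⇒^^≈ε : ∀ {p x} → Torsion p x → ∃[ j ] x ^^ (p ^ j) ≈ ε
  torsion⇒^^≈ε {p} {x} (j , im) = j , resp-image (λ i →
    trans (sym (^^-pointwise x (p ^ j) i)) (sym (ℤ.+-identityʳ _))) im

  ^^≈ε⇒torsion : ∀ {p x} → ∃[ j ] x ^^ (p ^ j) ≈ ε → Torsion p x
  ^^≈ε⇒torsion {p} {x} (j , im) = j , resp-image (λ i →
    trans (ℤ.+-identityʳ _) (^^-pointwise x (p ^ j) i)) im

  torsion-resp : ∀ {p x y} → x ≈ y → Torsion p x → Torsion p y
  torsion-resp {p} {x} {y} x≈y (j , im) = j , resp-image (λ i → cancel (+ (p ^ j)) (x i) (y i))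
    (add-image im (scale-image (- + (p ^ j)) x≈y))
    where
    cancel : ∀ r x y → r * x + (- r) * (x - y) ≡ r * y
    cancel = solve-∀

  torsion-scale : ∀ {p x} c → Torsion p x → Torsion p (λ i → c * x i)
  torsion-scale {p} {x} c (j , im) = j , resp-image (λ i → swap c (+ (p ^ j)) (x i)) (scale-image c im)
    where
    swap : ∀ c r x → c * (r * x) ≡ r * (c * x)
    swap = solve-∀

  torsion-add : ∀ {p x y} → Torsion p x → Torsion p y → Torsion p (λ i → x i + y i)
  torsion-add {p} {x} {y} (j , im) (k , im′) = j ℕ.+ k , resp-image
    (λ i → trans (regroup (+ (p ^ j)) (+ (p ^ k)) (x i) (y i))
      (cong (_* (x i + y i)) (trans (sym (ℤ.pos-* (p ^ j) (p ^ k))) (cong +_ (sym (ℕ.^-distribˡ-+-* p j k))))))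
    (add-image (scale-image (+ (p ^ k)) im) (scale-image (+ (p ^ j)) im′))
    where
    regroup : ∀ r s x y → s * (r * x) + r * (s * y) ≡ (r * s) * (x + y)
    regroup = solve-∀

  torsion-isSubgroup : ∀ p → IsSubgroup (Torsion p)
  torsion-isSubgroup p = record
    { resp      = torsion-resp
    ; ε-closed  = 0 , (λ _ → 0ℤ) , λ i → sym (trans (sum-cong-≗ (λ j → ℤ.*-zeroʳ (A i j))) (sum-replicate-zero n))
    ; ∙-closed  = torsion-add
    ; ⁻¹-closed = λ {x} τ → torsion-resp
        ((λ _ → 0ℤ) , λ i → trans (neg (x i)) (sym (trans (sum-cong-≗ (λ j → ℤ.*-zeroʳ (A i j))) (sum-replicate-zero n))))
        (torsion-scale (- 1ℤ) τ)
    }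
    where
    neg : ∀ x → (- 1ℤ) * x - (- x) ≡ 0ℤ
    neg = solve-∀

  -- In an abelian group the elements of p-power order already form a subgroup, and it contains
  -- every p-subgroup.
  torsion-isSylow : ∀ p → IsSylow p (Torsion p)
  torsion-isSylow p = record
    { isSubgroup = torsion-isSubgroup p
    ; isPGroup   = torsion⇒^^≈ε
    ; maximal    = λ Q _ isP _ y∈Q → ^^≈ε⇒torsion (isP y∈Q)
    }

  -- Maximality of `P` is tested against the torsion subgroup itself. Hence every Sylow subgroup has
  -- the same elements as `Torsion p`, and an arbitrary `P` can be treated through it.
  torsion⊆sylow : ∀ {p} {P : Pred (Fin n → ℤ) 0ℓ} → IsSylow p P → Torsion p ⊆ P
  torsion⊆sylow {p} {P} sylow = IsSylow.maximal sylow (Torsion p) (torsion-isSubgroup p) torsion⇒^^≈ε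
    (λ x∈P → ^^≈ε⇒torsion (IsSylow.isPGroup sylow x∈P))

-- Cokernel of an n × n integer matrix A with A² + γ A + D I = μ J

module QuadraticCokernel
  (A : Fin n → Fin n → ℤ) {p t : ℕ} .{{_ : ℕ.NonZero p}}
  {u D γ μ : ℤ}
  (row-sum    : ∀ i → sum (A i) ≡ + (p ^ t) * u)
  (column-sum : ∀ j → sum (λ i → A i j) ≡ + (p ^ t) * u)
  (quadratic  : ∀ i k → sum (λ j → A i j * A j k) + γ * A i k + D * 𝟙 (i Fin.≟ k) ≡ μ)
  (u≡1 : u ≡1[mod p ]) (D≡1 : D ≡1[mod p ]) (n≡1 : + n ≡1[mod p ])
  where

  open AbelianGroup (matrixCokernel A) using (_≈_; group)
  open Subgroups group
  open ≡-Reasoning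

  private
    q : ℕ
    q = p ^ t

    instance
      q≢0 : ℕ.NonZero q
      q≢0 = ℕ.m^n≢0 p t

  sum-image : ∀ z → sum (A ·ᵐ z) ≡ (+ q * u) * sum z
  sum-image z = begin
    sum (λ i → sum (λ j → A i j * z j)) ≡⟨ ∑-comm (λ i j → A i j * z j) ⟩
    sum (λ j → sum (λ i → A i j * z j)) ≡⟨ sum-cong-≗ (λ j → sym (*-distribʳ-sum (z j) (λ i → A i j))) ⟩
    sum (λ j → sum (λ i → A i j) * z j) ≡⟨ sum-cong-≗ (λ j → cong (_* z j) (column-sum j)) ⟩
    sum (λ j → (+ q * u) * z j)         ≡⟨ *-distribˡ-sum (+ q * u) z ⟨
    (+ q * u) * sum z                   ∎

  constant-image : ∀ s → InImage A (λ _ → s * (+ q * u))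
  constant-image s = (λ _ → s) , λ i → begin
    s * (+ q * u)         ≡⟨ ℤ.*-comm s _ ⟩
    (+ q * u) * s         ≡⟨ cong (_* s) (row-sum i) ⟨
    sum (A i) * s         ≡⟨ *-distribʳ-sum s (A i) ⟩
    sum (λ j → A i j * s) ∎

  quadratic-vector : ∀ x i → (A ·ᵐ (A ·ᵐ x)) i + γ * (A ·ᵐ x) i + D * x i ≡ μ * sum x
  quadratic-vector x i = begin
    (A ·ᵐ (A ·ᵐ x)) i + γ * (A ·ᵐ x) i + D * x i
      ≡⟨ cong₂ _+_ (cong₂ _+_ square (*-distribˡ-sum γ (λ k → A i k * x k)))
           (trans (cong (D *_) (sym (sum-δ x i))) (*-distribˡ-sum D (λ k → 𝟙 (i Fin.≟ k) * x k))) ⟩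
    sum (λ k → sum (λ j → A i j * A j k) * x k) + sum (λ k → γ * (A i k * x k)) + sum (λ k → D * (𝟙 (i Fin.≟ k) * x k))
      ≡⟨ cong (_+ sum (λ k → D * (𝟙 (i Fin.≟ k) * x k))) (sym (∑-distrib-+ (λ k → sum (λ j → A i j * A j k) * x k) _)) ⟩
    sum (λ k → sum (λ j → A i j * A j k) * x k + γ * (A i k * x k)) + sum (λ k → D * (𝟙 (i Fin.≟ k) * x k))
      ≡⟨ ∑-distrib-+ (λ k → sum (λ j → A i j * A j k) * x k + γ * (A i k * x k)) _ ⟨
    sum (λ k → sum (λ j → A i j * A j k) * x k + γ * (A i k * x k) + D * (𝟙 (i Fin.≟ k) * x k))
      ≡⟨ sum-cong-≗ (λ k → trans
           (factor (sum (λ j → A i j * A j k)) γ (A i k) D (𝟙 (i Fin.≟ k)) (x k)) (cong (_* x k) (quadratic i k))) ⟩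
    sum (λ k → μ * x k)
      ≡⟨ *-distribˡ-sum μ x ⟨
    μ * sum x ∎
    where
    factor : ∀ s γ a D δ x → s * x + γ * (a * x) + D * (δ * x) ≡ (s + γ * a + D * δ) * x
    factor = solve-∀
    square : (A ·ᵐ (A ·ᵐ x)) i ≡ sum (λ k → sum (λ j → A i j * A j k) * x k)
    square = begin
      sum (λ j → A i j * sum (λ k → A j k * x k))   ≡⟨ sum-cong-≗ (λ j → *-distribˡ-sum (A i j) (λ k → A j k * x k)) ⟩
      sum (λ j → sum (λ k → A i j * (A j k * x k))) ≡⟨ ∑-comm (λ j k → A i j * (A j k * x k)) ⟩
      sum (λ k → sum (λ j → A i j * (A j k * x k))) ≡⟨ sum-cong-≗ (λ k → trans
          (sum-cong-≗ (λ j → sym (ℤ.*-assoc (A i j) (A j k) (x k))))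
          (sym (*-distribʳ-sum (x k) (λ j → A i j * A j k)))) ⟩
      sum (λ k → sum (λ j → A i j * A j k) * x k)   ∎

  -- The quadratic relation says D x - μ σ(x) 1 = A (- A x - γ x).
  D-image : ∀ x → InImage A (λ i → D * x i - μ * sum x)
  D-image x = resp-image A
    (λ i → trans (cancel ((A ·ᵐ (A ·ᵐ x)) i) γ ((A ·ᵐ x) i) D (x i)) (cong (_-_ (D * x i)) (quadratic-vector x i)))
    (add-image A (scale-image A (- 1ℤ) ((A ·ᵐ x) , λ _ → refl)) (scale-image A (- γ) (x , λ _ → refl)))
    where
    cancel : ∀ s γ a D x → (- 1ℤ) * s + (- γ) * a ≡ D * x - (s + γ * a + D * x)
    cancel = solve-∀

  -- On classes of p-power order the coordinate sum modulo q is injective: D u is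
  -- invertible there, and it sends x to a multiple of q u times the all-ones class.
  torsion-injective : ∀ {x} m → sum x ≡ m * + q → Torsion A p x → InImage A x
  torsion-injective {x} m σ≡ (j , im) with e , f , eq ← bezout (≡1-* D≡1 u≡1) j =
    resp-image A
      (λ i → trans (cong (λ s → e * (u * (D * x i - μ * s) + (μ * m) * (+ q * u)) + f * (+ (p ^ j) * x i)) σ≡)
        (trans (collect D u e f μ m (+ q) (+ (p ^ j)) (x i)) (trans (cong (_* x i) eq) (ℤ.*-identityˡ (x i)))))
      (add-image A
        (scale-image A e (add-image A (scale-image A u (D-image x)) (constant-image (μ * m))))
        (scale-image A f im))
    where
    collect : ∀ D u e f μ m q r x →
      e * (u * (D * x - μ * (m * q)) + (μ * m) * (q * u)) + f * (r * x) ≡ ((D * u) * e + r * f) * x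
    collect = solve-∀

  -- Only q u [1] = 0 is known of the all-ones class; the factor u turns it into a class killed by
  -- q.
  generator : Fin n → ℤ
  generator _ = u

  generator-torsion : Torsion A p generator
  generator-torsion = t , resp-image A (λ _ → ℤ.*-identityˡ (+ q * u)) (constant-image 1ℤ)

  private
    -- The generator has coordinate sum u n, so e inverts that sum modulo q.
    inverse = bezout (≡1-* u≡1 n≡1) t
    e = proj₁ inverse
    f = proj₁ (proj₂ inverse)

    une≡1 : (u * + n) * e + + q * f ≡ 1ℤ
    une≡1 = proj₂ (proj₂ inverse)

  -- This makes (c e) times the generator the preimage of the residue c under σ, with the error term
  -- displayed as a multiple of q.
  sum-generator : ∀ c → sum (λ i → (c * e) * generator i) ≡ c - (c * f) * + q
  sum-generator c = begin
    sum {n} (λ _ → (c * e) * u)                     ≡⟨ sum-const n ((c * e) * u) ⟩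
    + n * ((c * e) * u)                             ≡⟨ expand c e f u (+ n) (+ q) ⟩
    c * ((u * + n) * e + + q * f) - (c * f) * + q   ≡⟨ cong (λ s → c * s - (c * f) * + q) une≡1 ⟩
    c * 1ℤ - (c * f) * + q                          ≡⟨ cong (_- (c * f) * + q) (ℤ.*-identityʳ c) ⟩
    c - (c * f) * + q                               ∎
    where
    expand : ∀ c e f u n q → n * ((c * e) * u) ≡ c * ((u * n) * e + q * f) - (c * f) * q
    expand = solve-∀

  sum-cong-mod : ∀ {x y} → x ≈ y → ∃[ m ] sum x ≡ sum y + m * + q
  sum-cong-mod {x} {y} (z , eq) = u * sum z , (begin
    sum x                           ≡⟨ split (sum x) (sum y) ⟩
    sum y + (sum x - sum y)         ≡⟨ cong (_+_ (sum y)) (sum-sub x y) ⟨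
    sum y + sum (λ i → x i - y i)   ≡⟨ cong (_+_ (sum y)) (trans (sum-cong-≗ eq) (sum-image z)) ⟩
    sum y + (+ q * u) * sum z       ≡⟨ cong (_+_ (sum y)) (swap (+ q) u (sum z)) ⟩
    sum y + (u * sum z) * + q       ∎)
    where
    split : ∀ a b → a ≡ b + (a - b)
    split = solve-∀
    swap : ∀ q u s → (q * u) * s ≡ (u * s) * q
    swap = solve-∀

  -- The two sides differ by a p-torsion vector whose coordinate sum is divisible by q, to which
  -- `torsion-injective` applies. Leaving c free serves twice: c = σ(x) gives cyclicity, c the
  -- residue of σ(x) gives the bijection with `Fin q`.
  torsion-generated : ∀ {x} → Torsion A p x → ∀ c m → sum x ≡ c + m * + q → x ≈ λ i → (c * e) * generator i
  torsion-generated {x} τ c m eq = torsion-injective {λ i → x i - (c * e) * generator i} (m + c * f)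
    (trans (sum-sub x (λ i → (c * e) * generator i)) (trans (cong₂ _-_ eq (sum-generator c)) (collect c m f (+ q))))
    (torsion-add A τ (resp {λ i → (c * e) * generator i} (torsion-scale A (- 1ℤ) (torsion-scale A (c * e) generator-torsion))))
    where
    collect : ∀ c m f q → (c + m * q) - (c - (c * f) * q) ≡ (m + c * f) * q
    collect = solve-∀
    resp : ∀ {y} → Torsion A p (λ i → (- 1ℤ) * y i) → Torsion A p (λ i → - y i)
    resp {y} (j , im) = j , resp-image A (λ i → cong (+ (p ^ j) *_) (ℤ.-1*i≡-i (y i))) im

  sylow-isCyclic : ∀ {P : Pred (Fin n → ℤ) 0ℓ} → IsSylow p P → IsCyclic P
  sylow-isCyclic sylow = generator , torsion⊆sylow A sylow generator-torsion ,
    λ {y} y∈P → sum y * e , resp {y} {sum y * e}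
      (torsion-generated (^^≈ε⇒torsion A (IsSylow.isPGroup sylow y∈P)) (sum y) 0ℤ (sym (ℤ.+-identityʳ _)))
    where
    resp : ∀ {y c} → y ≈ (λ i → c * generator i) → y ≈ generator ^ᶻ c
    resp {y} {c} = resp-image A (λ i → cong (_-_ (y i)) (sym (^ᶻ-pointwise A generator c i)))

  -- The bijection is σ modulo q, with inverse r ↦ (r e) times the generator.
  sylow-hasOrder : ∀ {P : Pred (Fin n → ℤ) 0ℓ} → IsSylow p P → HasOrder P q
  sylow-hasOrder {P} sylow = record
    { to        = residue
    ; from      = multiple
    ; to-cong   = λ {x} {y} → residue-cong x y
    ; from-cong = λ { {r} refl → AbelianGroup.refl (matrixCokernel A) {proj₁ (multiple r)} }
    ; inverse   = (λ {r} {x} → inverseˡ r x) , (λ { {x} refl → inverseʳ x })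
    }
    where
    residue : ∃ P → Fin q
    residue (x , _) = fromℕ< (n%ℕd<d (sum x) q)

    multiple : Fin q → ∃ P
    multiple r = (λ i → (+ toℕ r * e) * generator i) ,
      torsion⊆sylow A sylow (torsion-scale A (+ toℕ r * e) generator-torsion)

    residue-cong : ∀ (x y : ∃ P) → proj₁ x ≈ proj₁ y → residue x ≡ residue y
    residue-cong (x , _) (y , _) x≈y with m , eq ← sum-cong-mod {x} {y} x≈y =
      Fin.fromℕ<-cong _ _ (%ℕ-cong {sum x} {sum y} q m eq) _ _

    inverseˡ : ∀ r (x : ∃ P) → proj₁ x ≈ proj₁ (multiple r) → residue x ≡ r
    inverseˡ r (x , _) x≈ with m , eq ← sum-cong-mod {x} {proj₁ (multiple r)} x≈ = trans
      (Fin.fromℕ<-cong _ _ (trans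
        (%ℕ-cong {sum x} {+ toℕ r} q (m - + toℕ r * f) (trans eq (trans
          (cong (_+ m * + q) (sum-generator (+ toℕ r))) (collect (+ toℕ r) m f (+ q)))))
        (ℕ.m<n⇒m%n≡m (Fin.toℕ<n r))) _ _)
      (Fin.fromℕ<-toℕ r (Fin.toℕ<n r))
      where
      collect : ∀ c m f q → c - (c * f) * q + m * q ≡ c + (m - c * f) * q
      collect = solve-∀

    inverseʳ : (x : ∃ P) → proj₁ (multiple (residue x)) ≈ proj₁ x
    inverseʳ (x , x∈P) = AbelianGroup.sym (matrixCokernel A) {x} {proj₁ (multiple (residue (x , x∈P)))}
      (torsion-generated (^^≈ε⇒torsion A (IsSylow.isPGroup sylow x∈P)) (+ toℕ (residue (x , x∈P))) (sum x /ℕ q)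
        (subst (λ r → sum x ≡ + r + (sum x /ℕ q) * + q) (sym (Fin.toℕ-fromℕ< _)) (a≡a%ℕn+[a/ℕn]*n (sum x) q)))

-- Counting vectors and subspaces

funToFin-cong : {f g : Fin k → Fin n} → f ≗ g → funToFin f ≡ funToFin g
funToFin-cong {zero}  f≗g = refl
funToFin-cong {suc k} f≗g = cong₂ combine (f≗g zero) (funToFin-cong (f≗g ∘ suc))

module Counting
  {c ℓ₁ ℓ₂ m ℓm} (F : HeytingField c ℓ₁ ℓ₂) (V : VectorSpace F m ℓm) {q n : ℕ}
  (F-card : HasCardinality (CommutativeRing.setoid (fieldRing F)) q)
  (V-dim : LinearAlgebra.HasDimension F V U n)
  where

  open LinearAlgebra F V
  open SubspaceOfDimension
  open FiniteVectorSpace F V F-card V-dim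
  open Module V
  private
    module K = CommutativeRing (fieldRing F)
    module H = HeytingField F
    module I = Inverse F-card
    module KG = GroupProperties K.+-group
    module VG = GroupProperties +ᴹ-group
    module VS = SumProperties +ᴹ-commutativeMonoid

  -- a # 0# is only available doubly negated, hence the search for an inverse.
  invert : ∀ {a} → ¬ (a K.≈ K.0#) → ∃[ b ] b K.* a K.≈ K.1#
  invert {a} a≉0 with Fin.any? (λ j → (I.from j K.* a) ≟ K.1#)
  ... | yes (j , eq) = I.from j , eq
  ... | no none      = contradiction (proj₁ (H.tight a K.0#) not-apart) a≉0
    where
    not-apart : ¬ (a H.# K.0#)
    not-apart a#0 with b , eq , _ ← H.#⇒invertible a#0 = none (I.to b , K.trans
      (K.*-cong (I.inverseʳ refl) (K.sym (K.trans (K.+-congˡ KG.ε⁻¹≈ε) (K.+-identityʳ a)))) eq)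

  lc-add : ∀ {k} (a a′ : Fin k → K.Carrier) (b : Fin k → Carrierᴹ) →
           linearCombination (λ i → a i K.+ a′ i) b ≈ᴹ linearCombination a b +ᴹ linearCombination a′ b
  lc-add a a′ b = ≈ᴹ-trans (VS.sum-cong-≋ (λ i → *ₗ-distribʳ (b i) (a i) (a′ i)))
    (VS.∑-distrib-+ (λ i → a i *ₗ b i) (λ i → a′ i *ₗ b i))

  lc-injective : ∀ {k} {b : Fin k → Carrierᴹ} → LinearlyIndependent b → ∀ {a a′} →
                 linearCombination a b ≈ᴹ linearCombination a′ b → ∀ i → a i K.≈ a′ i
  lc-injective {b = b} ind {a} {a′} eq i = KG.x∙y⁻¹≈ε⇒x≈y (a i) (a′ i) (ind (λ i → a i K.- a′ i) difference i)
    where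
    difference : linearCombination (λ i → a i K.- a′ i) b ≈ᴹ 0ᴹ
    difference = VG.identityˡ-unique _ (linearCombination a′ b) (≈ᴹ-trans
      (≈ᴹ-sym (lc-add (λ i → a i K.- a′ i) a′ b))
      (≈ᴹ-trans (lc-cong (λ i → KG.//-rightDividesˡ (a′ i) (a i)) (λ _ → ≈ᴹ-refl)) eq))

  coordinates-injective : ∀ {k} (j j′ : Fin (q ^ k)) → (∀ i → coordinates j i K.≈ coordinates j′ i) → j ≡ j′
  coordinates-injective {k} j j′ eq = trans (sym (Fin.funToFin-finToFin {k} {q} j)) (trans
    (funToFin-cong {k} (λ i → trans (sym (I.inverseˡ K.refl)) (trans (I.to-cong (eq i)) (I.inverseˡ K.refl))))
    (Fin.funToFin-finToFin {k} {q} j′))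

  vector-injective : ∀ j j′ → vector j ≈ᴹ vector j′ → j ≡ j′
  vector-injective j j′ eq = coordinates-injective {n} j j′
    (lc-injective (IsBasis.independent (proj₂ V-dim)) eq)

  count-vector : ∀ x → sum {q ^ n} (λ j → 𝟙 (vector j ≟ᴹ x)) ≡ 1ℤ
  count-vector x with i , x≈ ← vector-surjective x = count-unique (λ j → vector j ≟ᴹ x) i (≈ᴹ-sym x≈)
    (λ j vⱼ≈x → vector-injective j i (≈ᴹ-trans vⱼ≈x x≈))

  -- Counts the pairs (vector of P, its coordinates) in two ways.
  count-subspace : ∀ {ℓ k} {P : Pred Carrierᴹ ℓ} (P? : ∀ x → Dec (x ∈ P)) → IsSubspace P →
                   {b : Fin k → Carrierᴹ} → IsBasis P b →
                   sum {q ^ n} (λ j → 𝟙 (P? (vector j))) ≡ + (q ^ k)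
  count-subspace {k = k} {P} P? sub {b} basis = begin
    sum (λ j → 𝟙 (P? (vector j)))                                   ≡⟨ sum-cong-≗ (sym ∘ coordinate-count) ⟩
    sum (λ j → sum (λ i → 𝟙 (vector j ≟ᴹ combination i)))           ≡⟨ ∑-comm (λ j i → 𝟙 (vector j ≟ᴹ combination i)) ⟩
    sum (λ i → sum (λ j → 𝟙 (vector j ≟ᴹ combination i)))           ≡⟨ sum-cong-≗ (count-vector ∘ combination) ⟩
    sum {q ^ k} (λ _ → 1ℤ)                                          ≡⟨ sum-const (q ^ k) 1ℤ ⟩
    + (q ^ k) * 1ℤ                                                  ≡⟨ ℤ.*-identityʳ (+ (q ^ k)) ⟩
    + (q ^ k)                                                       ∎
    where
    open ≡-Reasoning
    open IsBasis basis

    combination : Fin (q ^ k) → Carrierᴹ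
    combination i = linearCombination (coordinates i) b

    coordinate-count : ∀ j → sum (λ i → 𝟙 (vector j ≟ᴹ combination i)) ≡ 𝟙 (P? (vector j))
    coordinate-count j with P? (vector j)
    ... | no ∉P = trans (sum-cong-≗ {q ^ k} (λ i → 𝟙-no (vector j ≟ᴹ combination i)
            (λ eq → ∉P (IsSubspace.resp sub (≈ᴹ-sym eq) (lc-closed sub (coordinates i) elements)))))
          (sum-replicate-zero (q ^ k))
    ... | yes ∈P with a , v≈ ← spanning ∈P with i , a≈ ← coordinates-surjective a =
          count-unique (λ i → vector j ≟ᴹ combination i) i
            (≈ᴹ-trans v≈ (lc-cong a≈ (λ _ → ≈ᴹ-refl)))
            (λ i′ eq → coordinates-injective {k} i′ i (lc-injective independent
              (≈ᴹ-trans (≈ᴹ-sym eq) (≈ᴹ-trans v≈ (lc-cong a≈ (λ _ → ≈ᴹ-refl))))))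

  count-nonzero : ∀ {ℓ k} {P : Pred Carrierᴹ ℓ} (P? : ∀ x → Dec (x ∈ P)) → IsSubspace P →
                  {b : Fin k → Carrierᴹ} → IsBasis P b →
                  sum {q ^ n} (λ j → 𝟙 (P? (vector j) ×-dec ¬? (≈0? (vector j)))) ≡ + (q ^ k) - 1ℤ
  count-nonzero {k = k} {P} P? sub {b} basis = begin
    S                        ≡⟨ split S (sum {q ^ n} (λ j → 𝟙 (≈0? (vector j)))) ⟩
    (S + sum {q ^ n} (λ j → 𝟙 (≈0? (vector j)))) - sum {q ^ n} (λ j → 𝟙 (≈0? (vector j)))
      ≡⟨ cong₂ _-_ (trans (sym (∑-distrib-+ {q ^ n}
               (λ j → 𝟙 (P? (vector j) ×-dec ¬? (≈0? (vector j)))) (λ j → 𝟙 (≈0? (vector j)))))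
           (trans (sum-cong-≗ (pointwise ∘ vector)) (count-subspace P? sub basis)))
         (trans (sum-cong-≗ {q ^ n} (λ j → 𝟙-⇔ (≈0? (vector j)) (vector j ≟ᴹ 0ᴹ) id id)) (count-vector 0ᴹ)) ⟩
    + (q ^ k) - 1ℤ           ∎
    where
    open ≡-Reasoning
    S : ℤ
    S = sum {q ^ n} (λ j → 𝟙 (P? (vector j) ×-dec ¬? (≈0? (vector j))))
    split : ∀ a b → a ≡ (a + b) - b
    split = solve-∀
    pointwise : ∀ x → 𝟙 (P? x ×-dec ¬? (≈0? x)) + 𝟙 (≈0? x) ≡ 𝟙 (P? x)
    pointwise x with P? x | ≈0? x
    ... | yes _  | yes _   = refl
    ... | yes _  | no _    = refl
    ... | no _   | no _    = refl
    ... | no ∉P  | yes x≈0 = contradiction (IsSubspace.resp sub (≈ᴹ-sym x≈0) (IsSubspace.0-closed sub)) ∉P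

  -- Spans of one and of two vectors

  point : Carrierᴹ → Fin 1 → Carrierᴹ
  point v _ = v

  pair : Carrierᴹ → Carrierᴹ → Fin 2 → Carrierᴹ
  pair v w zero    = v
  pair v w (suc _) = w

  lc-point : ∀ a v → linearCombination a (point v) ≈ᴹ a zero *ₗ v
  lc-point a v = +ᴹ-identityʳ _

  lc-pair : ∀ a v w → linearCombination a (pair v w) ≈ᴹ a zero *ₗ v +ᴹ a (suc zero) *ₗ w
  lc-pair a v w = +ᴹ-congˡ (+ᴹ-identityʳ _)

  scale-cancel : ∀ {a v} → a *ₗ v ≈ᴹ 0ᴹ → ¬ (v ≈ᴹ 0ᴹ) → a K.≈ K.0#
  scale-cancel {a} {v} av≈0 v≉0 with a ≟ K.0#
  ... | yes a≈0 = a≈0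
  ... | no a≉0 with b , ba≈1 ← invert a≉0 = contradiction (begin
    v              ≈⟨ *ₗ-identityˡ v ⟨
    K.1# *ₗ v      ≈⟨ *ₗ-congʳ ba≈1 ⟨
    (b K.* a) *ₗ v ≈⟨ *ₗ-assoc b a v ⟩
    b *ₗ (a *ₗ v)  ≈⟨ *ₗ-congˡ av≈0 ⟩
    b *ₗ 0ᴹ        ≈⟨ *ₗ-zeroʳ b ⟩
    0ᴹ             ∎) v≉0
    where open import Relation.Binary.Reasoning.Setoid ≈ᴹ-setoid

  point-independent : ∀ {v} → ¬ (v ≈ᴹ 0ᴹ) → LinearlyIndependent (point v)
  point-independent {v} v≉0 a eq zero = scale-cancel (≈ᴹ-trans (≈ᴹ-sym (lc-point a v)) eq) v≉0

  ∈-scale⁻¹ : ∀ {ℓ} {P : Pred Carrierᴹ ℓ} → IsSubspace P → ∀ {a v} → ¬ (a K.≈ K.0#) → a *ₗ v ∈ P → v ∈ P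
  ∈-scale⁻¹ sub {a} {v} a≉0 av∈P with b , ba≈1 ← invert a≉0 = IsSubspace.resp sub (begin
    b *ₗ (a *ₗ v)  ≈⟨ *ₗ-assoc b a v ⟨
    (b K.* a) *ₗ v ≈⟨ *ₗ-congʳ ba≈1 ⟩
    K.1# *ₗ v      ≈⟨ *ₗ-identityˡ v ⟩
    v              ∎) (IsSubspace.*ₗ-closed sub b av∈P)
    where open import Relation.Binary.Reasoning.Setoid ≈ᴹ-setoid

  -ᴹ-closed : ∀ {ℓ} {P : Pred Carrierᴹ ℓ} → IsSubspace P → ∀ {v} → v ∈ P → -ᴹ v ∈ P
  -ᴹ-closed sub {v} v∈P = IsSubspace.resp sub (VG.inverseˡ-unique _ v (begin
    (K.- K.1#) *ₗ v +ᴹ v          ≈⟨ +ᴹ-congˡ (*ₗ-identityˡ v) ⟨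
    (K.- K.1#) *ₗ v +ᴹ K.1# *ₗ v  ≈⟨ *ₗ-distribʳ v (K.- K.1#) K.1# ⟨
    (K.- K.1# K.+ K.1#) *ₗ v      ≈⟨ *ₗ-congʳ (K.-‿inverseˡ K.1#) ⟩
    K.0# *ₗ v                     ≈⟨ *ₗ-zeroˡ v ⟩
    0ᴹ                            ∎)) (IsSubspace.*ₗ-closed sub (K.- K.1#) v∈P)
    where open import Relation.Binary.Reasoning.Setoid ≈ᴹ-setoid

  -- A nonzero second coefficient would make w a multiple of v; once it vanishes, v ≠ 0 forces the
  -- first to vanish too.
  pair-independent : ∀ {v w} → ¬ (v ≈ᴹ 0ᴹ) → w ∉ Span (point v) → LinearlyIndependent (pair v w)
  pair-independent {v} {w} v≉0 w∉v a eq = λ { zero → a₀≈0 ; (suc zero) → a₁≈0 }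
    where
    sub = span-isSubspace (point v)
    eq′ : a zero *ₗ v +ᴹ a (suc zero) *ₗ w ≈ᴹ 0ᴹ
    eq′ = ≈ᴹ-trans (≈ᴹ-sym (lc-pair a v w)) eq

    a₁≈0 : a (suc zero) K.≈ K.0#
    a₁≈0 with a (suc zero) ≟ K.0#
    ... | yes ≈0 = ≈0
    ... | no ≉0  = contradiction (∈-scale⁻¹ sub ≉0 (IsSubspace.resp sub (≈ᴹ-sym (VG.inverseʳ-unique _ _ eq′))
            (-ᴹ-closed sub (IsSubspace.*ₗ-closed sub (a zero) (basis⊆span (point v) zero))))) w∉v

    a₀≈0 : a zero K.≈ K.0#
    a₀≈0 = scale-cancel (≈ᴹ-trans (≈ᴹ-sym (≈ᴹ-trans
      (+ᴹ-congˡ (≈ᴹ-trans (*ₗ-congʳ a₁≈0) (*ₗ-zeroˡ w))) (+ᴹ-identityʳ _))) eq′) v≉0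

  ∈-point-sym : ∀ {v w} → ¬ (w ≈ᴹ 0ᴹ) → w ∈ Span (point v) → v ∈ Span (point w)
  ∈-point-sym {v} {w} w≉0 (a , w≈) = ∈-scale⁻¹ (span-isSubspace (point w))
    (λ a≈0 → w≉0 (≈ᴹ-trans w≈av (≈ᴹ-trans (*ₗ-congʳ a≈0) (*ₗ-zeroˡ v))))
    (IsSubspace.resp (span-isSubspace (point w)) w≈av (basis⊆span (point w) zero))
    where
    w≈av : w ≈ᴹ a zero *ₗ v
    w≈av = ≈ᴹ-trans w≈ (lc-point a v)

  span-basis : ∀ {k} {b : Fin k → Carrierᴹ} → LinearlyIndependent b → IsBasis (Span b) b
  span-basis {b = b} ind = record { elements = basis⊆span b ; independent = ind ; spanning = id }

  -- Both sides have q ^ k elements.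
  independent⇒spanning : ∀ {k} (S : SubspaceOfDimension k) {b : Fin k → Carrierᴹ} → LinearlyIndependent b →
                         (∀ i → b i ∈ member S) → member S ⊆ Span b
  independent⇒spanning S {b} ind b∈S {x} x∈S with j , x≈ ← vector-surjective x =
    IsSubspace.resp (span-isSubspace b) (≈ᴹ-sym x≈)
      (count-≡⇒⊇ (λ j → span? b (vector j)) (λ j → member? S (vector j))
        (λ j → span⊆ (isSubspace S) b∈S)
        (trans (count-subspace (span? b) (span-isSubspace b) (span-basis ind))
          (sym (count-subspace (member? S) (isSubspace S) (proj₂ (hasDimension S)))))
        j (IsSubspace.resp (isSubspace S) x≈ x∈S))

  pair-∈ : ∀ {ℓ} {P : Pred Carrierᴹ ℓ} {v w} → v ∈ P → w ∈ P → ∀ i → pair v w i ∈ P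
  pair-∈ v∈P w∈P zero    = v∈P
  pair-∈ v∈P w∈P (suc _) = w∈P

  point-basis : ∀ {v} → ¬ (v ≈ᴹ 0ᴹ) → IsBasis (Span (point v)) (point v)
  point-basis v≉0 = span-basis (point-independent v≉0)

  -- l is the number of lines through a point, (q ^ n - q) / (q ^ 2 - q).
  module Incidence (2≤q : 2 ≤ q) (l : ℤ) (qⁿ≡ : + (q ^ n) ≡ + q + (+ q - 1ℤ) * + q * l) where

    open FiniteGraph (grassmannGraph F V F-card V-dim) using (order; vertex; enumeration; adjacencyMatrix; _~?_; ~-sym)
    open ≡-Reasoning

    private
      Q s : ℤ
      Q = + q
      s = Q - 1ℤ

      Vector : Set
      Vector = Fin (q ^ n)

      nonZero : ∀ {k} → 2 ≤ k → NonZero (+ k)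
      nonZero (ℕ.s≤s _) = _

      instance
        Q≢0 : NonZero Q
        Q≢0 = nonZero 2≤q
        s≢0 : NonZero s
        s≢0 = nonZero-pred 2≤q

      pos-q¹ : + (q ^ 1) ≡ Q
      pos-q¹ = cong +_ (ℕ.*-identityʳ q)

      pos-q² : + (q ^ 2) ≡ Q * Q
      pos-q² = trans (ℤ.pos-* q (q ^ 1)) (cong (Q *_) pos-q¹)

    -- Incidence of lines with vectors

    δ : Fin order → Fin order → ℤ
    δ i j = 𝟙 (i Fin.≟ j)

    contains : Fin order → Vector → ℤ
    contains i x = 𝟙 (member? (vertex i) (vector x))

    nonzeroMember? : ∀ i x → Dec (vector x ∈ member (vertex i) × ¬ (vector x ≈ᴹ 0ᴹ))
    nonzeroMember? i x = member? (vertex i) (vector x) ×-dec ¬? (≈0? (vector x))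

    -- The matrix N. The zero vector stays as an index, with a zero column, so that all sums run
    -- over `Vector`; `contains` differs from it only in that column. Each projective point occurs
    -- as q - 1 columns, whence the factors s below.
    incidence : Fin order → Vector → ℤ
    incidence i x = 𝟙 (nonzeroMember? i x)

    multiple : Vector → Vector → ℤ
    multiple x y = 𝟙 (span? (point (vector x)) (vector y))

    incidence-zero : ∀ i {x} → vector x ≈ᴹ 0ᴹ → incidence i x ≡ 0ℤ
    incidence-zero i {x} x≈0 = 𝟙-no (nonzeroMember? i x) (λ (_ , x≉0) → x≉0 x≈0)

    incidence-nonzero : ∀ i {x} → ¬ (vector x ≈ᴹ 0ᴹ) → incidence i x ≡ contains i x
    incidence-nonzero i {x} x≉0 = 𝟙-⇔ (nonzeroMember? i x)
      (member? (vertex i) (vector x)) proj₁ (_, x≉0)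

    count-line : ∀ i → sum (contains i) ≡ Q * Q
    count-line i = trans (count-subspace (member? (vertex i)) (isSubspace (vertex i)) (proj₂ (hasDimension (vertex i)))) pos-q²

    count-multiples : ∀ x → ¬ (vector x ≈ᴹ 0ᴹ) → sum (multiple x) ≡ Q
    count-multiples x x≉0 = trans
      (count-subspace (span? (point (vector x))) (span-isSubspace (point (vector x))) (point-basis x≉0))
      pos-q¹

    incidence-row-sum : ∀ i → sum (incidence i) ≡ s * (Q + 1ℤ)
    incidence-row-sum i = trans
      (count-nonzero (member? (vertex i)) (isSubspace (vertex i)) (proj₂ (hasDimension (vertex i))))
      (trans (cong (_- 1ℤ) pos-q²) (factor Q))
      where
      factor : ∀ q → q * q - 1ℤ ≡ (q - 1ℤ) * (q + 1ℤ)
      factor = solve-∀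

    -- The span of the two vectors is such a line, and any line containing both equals it by
    -- cardinality. The enumeration returns the span only up to `≐`, so membership is carried along
    -- that equivalence.
    lines-through-pair : ∀ {x y} → ¬ (vector x ≈ᴹ 0ᴹ) → vector y ∉ Span (point (vector x)) →
                         sum (λ i → contains i x * contains i y) ≡ 1ℤ
    lines-through-pair {x} {y} x≉0 y∉x = trans
      (sum-cong-≗ (λ i → sym (𝟙-× (member? (vertex i) (vector x)) (member? (vertex i) (vector y)))))
      (count-unique (λ i → member? (vertex i) (vector x) ×-dec member? (vertex i) (vector y))
        (E.to line)
        (line⊆ (basis⊆span b zero) , line⊆ (basis⊆span b (suc zero)))
        (λ j (x∈j , y∈j) → sym (E.inverseˡ {j} {line}
          ( span⊆ (isSubspace (vertex j)) {b} (pair-∈ {P = member (vertex j)} x∈j y∈j)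
          , independent⇒spanning (vertex j) {b} ind (pair-∈ {P = member (vertex j)} x∈j y∈j)))))
      where
      module E = Inverse enumeration
      b = pair (vector x) (vector y)
      ind = pair-independent x≉0 y∉x
      line : SubspaceOfDimension 2
      line = spanned b ind
      line⊆ : Span b ⊆ member (vertex (E.to line))
      line⊆ = proj₂ (E.inverseʳ {line} refl)

    -- Counts the pairs (line through x, vector on it independent of x).
    lines-through : ∀ {x} → ¬ (vector x ≈ᴹ 0ᴹ) → sum (λ i → contains i x) ≡ l
    lines-through {x} x≉0 = ℤ.*-cancelˡ-≡ s _ _ (ℤ.*-cancelˡ-≡ Q _ _ (begin
      Q * (s * L)
        ≡⟨ regroup Q L ⟩
      L * (Q * Q - Q)
        ≡⟨ *-distribʳ-sum (Q * Q - Q) (λ i → contains i x) ⟩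
      sum (λ i → contains i x * (Q * Q - Q))
        ≡⟨ sum-cong-≗ (λ i → off-multiples i (member? (vertex i) (vector x))) ⟩
      sum (λ i → contains i x * sum (λ y → contains i y * (1ℤ - multiple x y)))
        ≡⟨ sum-cong-≗ (λ i → *-distribˡ-sum (contains i x) (λ y → contains i y * (1ℤ - multiple x y))) ⟩
      sum (λ i → sum (λ y → contains i x * (contains i y * (1ℤ - multiple x y))))
        ≡⟨ ∑-comm (λ i y → contains i x * (contains i y * (1ℤ - multiple x y))) ⟩
      sum (λ y → sum (λ i → contains i x * (contains i y * (1ℤ - multiple x y))))
        ≡⟨ sum-cong-≗ (λ y → trans
             (sum-cong-≗ (λ i → sym (ℤ.*-assoc (contains i x) (contains i y) (1ℤ - multiple x y))))
             (trans (sym (*-distribʳ-sum (1ℤ - multiple x y) (λ i → contains i x * contains i y)))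
                    (unique y (span? (point (vector x)) (vector y))))) ⟩
      sum (λ y → 1ℤ - multiple x y)
        ≡⟨ sum-sub (λ _ → 1ℤ) (multiple x) ⟩
      sum {q ^ n} (λ _ → 1ℤ) - sum (multiple x)
        ≡⟨ cong₂ _-_ (trans (sum-const (q ^ n) 1ℤ) (trans (ℤ.*-identityʳ (+ (q ^ n))) qⁿ≡)) (count-multiples x x≉0) ⟩
      (Q + (Q - 1ℤ) * Q * l) - Q
        ≡⟨ cancel Q l ⟩
      Q * (s * l) ∎))
      where
      L = sum (λ i → contains i x)
      regroup : ∀ q l → q * ((q - 1ℤ) * l) ≡ l * (q * q - q)
      regroup = solve-∀
      cancel : ∀ q l → (q + (q - 1ℤ) * q * l) - q ≡ q * ((q - 1ℤ) * l)
      cancel = solve-∀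

      unique : ∀ y (d : Dec (vector y ∈ Span (point (vector x)))) →
               sum (λ i → contains i x * contains i y) * (1ℤ - 𝟙 d) ≡ 1ℤ - 𝟙 d
      unique y (yes _)   = ℤ.*-zeroʳ (sum (λ i → contains i x * contains i y))
      unique y (no y∉x)  = trans (ℤ.*-identityʳ _) (lines-through-pair x≉0 y∉x)

      off-multiples : ∀ i (d : Dec (vector x ∈ member (vertex i))) →
                      𝟙 d * (Q * Q - Q) ≡ 𝟙 d * sum (λ y → contains i y * (1ℤ - multiple x y))
      off-multiples i (no _)    = refl
      off-multiples i (yes x∈i) = cong (_*_ 1ℤ) (sym (begin
        sum (λ y → contains i y * (1ℤ - multiple x y)) ≡⟨ sum-cong-≗ pointwise ⟩
        sum (λ y → contains i y - multiple x y)        ≡⟨ sum-sub (contains i) (multiple x) ⟩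
        sum (contains i) - sum (multiple x)            ≡⟨ cong₂ _-_ (count-line i) (count-multiples x x≉0) ⟩
        Q * Q - Q                                      ∎))
        where
        pointwise : ∀ y → contains i y * (1ℤ - multiple x y) ≡ contains i y - multiple x y
        pointwise y with member? (vertex i) (vector y) | span? (point (vector x)) (vector y)
        ... | yes _  | yes _  = refl
        ... | yes _  | no _   = refl
        ... | no y∉i | yes y∈ = contradiction (span⊆ (isSubspace (vertex i)) (λ _ → x∈i) y∈) y∉i
        ... | no _   | no _   = refl

    incidence-column-sum : ∀ {x} → ¬ (vector x ≈ᴹ 0ᴹ) → sum (λ i → incidence i x) ≡ l
    incidence-column-sum x≉0 = trans (sum-cong-≗ (λ i → incidence-nonzero i x≉0)) (lines-through x≉0)

    -- The Gram matrix N Nᵀ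

    gram : Fin order → Fin order → ℤ
    gram i j = sum (λ x → incidence i x * incidence j x)

    -- Equal lines share q² - 1 = s (q + 1) nonzero vectors, distinct meeting lines share the s
    -- nonzero multiples of one vector, and other pairs share none.
    gram-adjacency : ∀ i j → gram i j ≡ s * adjacencyMatrix i j + (s * (Q + 1ℤ)) * δ i j
    gram-adjacency i j = by-cases (i Fin.≟ j) (meetNontrivially? (vertex i) (vertex j))
      where
      S = vertex i
      T = vertex j
      adjacent : ∀ {e} → 𝟙 (vertex i ~? vertex j) ≡ e → gram i j ≡ s * e + (s * (Q + 1ℤ)) * δ i j →
                 gram i j ≡ s * adjacencyMatrix i j + (s * (Q + 1ℤ)) * δ i j
      adjacent refl eq = eq
      simplify₁ : ∀ s r → s * 0ℤ + r * 1ℤ ≡ r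
      simplify₁ = solve-∀
      simplify₂ : ∀ s r → s * 1ℤ + r * 0ℤ ≡ s
      simplify₂ = solve-∀
      simplify₃ : ∀ s r → s * 0ℤ + r * 0ℤ ≡ 0ℤ
      simplify₃ = solve-∀
      product : ∀ x → incidence i x * incidence j x ≡
                𝟙 (nonzeroMember? i x ×-dec nonzeroMember? j x)
      product x = sym (𝟙-× (nonzeroMember? i x) (nonzeroMember? j x))

      by-cases : Dec (i ≡ j) → Dec (MeetNontrivially S T) →
                 gram i j ≡ s * adjacencyMatrix i j + (s * (Q + 1ℤ)) * δ i j
      by-cases (yes refl) _ = adjacent (𝟙-no (S ~? S) (λ (S≢S , _) → S≢S (id , id))) (begin
        gram i i                         ≡⟨ sum-cong-≗ (λ x → 𝟙-idem (nonzeroMember? i x)) ⟩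
        sum (incidence i)                ≡⟨ incidence-row-sum i ⟩
        s * (Q + 1ℤ)                     ≡⟨ simplify₁ s (s * (Q + 1ℤ)) ⟨
        s * 0ℤ + (s * (Q + 1ℤ)) * 1ℤ     ≡⟨ cong (λ e → s * 0ℤ + (s * (Q + 1ℤ)) * e) (𝟙-yes (i Fin.≟ i) refl) ⟨
        s * 0ℤ + (s * (Q + 1ℤ)) * δ i i  ∎)
      by-cases (no i≢j) (no trivial) = adjacent (𝟙-no (S ~? T) (trivial ∘ proj₂)) (begin
        gram i j                         ≡⟨ sum-cong-≗ (λ x → trans (product x) (𝟙-no
          (nonzeroMember? i x ×-dec nonzeroMember? j x)
          (λ ((x∈S , x≉0) , (x∈T , _)) → trivial (vector x , x∈S , x∈T , x≉0)))) ⟩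
        sum {q ^ n} (λ _ → 0ℤ)           ≡⟨ sum-replicate-zero (q ^ n) ⟩
        0ℤ                               ≡⟨ simplify₃ s (s * (Q + 1ℤ)) ⟨
        s * 0ℤ + (s * (Q + 1ℤ)) * 0ℤ     ≡⟨ cong (λ e → s * 0ℤ + (s * (Q + 1ℤ)) * e) (𝟙-no (i Fin.≟ j) i≢j) ⟨
        s * 0ℤ + (s * (Q + 1ℤ)) * δ i j  ∎)
      by-cases (no i≢j) (yes (z , z∈S , z∈T , z≉0)) = adjacent
        (𝟙-yes (S ~? T) (S≢T , z , z∈S , z∈T , z≉0)) (begin
        gram i j                         ≡⟨ sum-cong-≗ (λ x → trans (product x) (𝟙-⇔
          (nonzeroMember? i x ×-dec nonzeroMember? j x)
          (span? (point z) (vector x) ×-dec ¬? (≈0? (vector x)))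
          (λ ((x∈S , x≉0) , (x∈T , _)) → meet⊆span x∈S x∈T , x≉0)
          (λ (x∈z , x≉0) → (span⊆ (isSubspace S) (λ _ → z∈S) x∈z , x≉0)
                         , (span⊆ (isSubspace T) (λ _ → z∈T) x∈z , x≉0)))) ⟩
        sum {q ^ n} (λ x → 𝟙 (span? (point z) (vector x) ×-dec ¬? (≈0? (vector x))))
          ≡⟨ count-nonzero (span? (point z)) (span-isSubspace (point z)) (point-basis z≉0) ⟩
        + (q ^ 1) - 1ℤ                   ≡⟨ cong (_- 1ℤ) pos-q¹ ⟩
        s                                ≡⟨ simplify₂ s (s * (Q + 1ℤ)) ⟨
        s * 1ℤ + (s * (Q + 1ℤ)) * 0ℤ     ≡⟨ cong (λ e → s * 1ℤ + (s * (Q + 1ℤ)) * e) (𝟙-no (i Fin.≟ j) i≢j) ⟨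
        s * 1ℤ + (s * (Q + 1ℤ)) * δ i j  ∎)
        where
        S≢T : ¬ (member S ≐ member T)
        S≢T S≐T = i≢j (trans
          (sym (Inverse.inverseˡ enumeration {i} {T} (swap S≐T)))
          (Inverse.inverseˡ enumeration {j} {T} (id , id)))
          where
          swap : member S ≐ member T → member T ≐ member S
          swap (f , g) = g , f

        -- If x were not a multiple of z, then z and x would be independent vectors of both lines,
        -- and both lines would be their span.
        meet⊆span : ∀ {x} → x ∈ member S → x ∈ member T → x ∈ Span (point z)
        meet⊆span {x} x∈S x∈T with span? (point z) x
        ... | yes x∈z = x∈z
        ... | no x∉z  = contradiction S≐T S≢T
          where
          ind = pair-independent z≉0 x∉z
          S≐T : member S ≐ member T
          S≐T = (λ y∈S → span⊆ (isSubspace T) {pair z x} (pair-∈ {P = member T} z∈T x∈T)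
                  (independent⇒spanning S {pair z x} ind (pair-∈ {P = member S} z∈S x∈S) y∈S))
              , (λ y∈T → span⊆ (isSubspace S) {pair z x} (pair-∈ {P = member S} z∈S x∈S)
                  (independent⇒spanning T {pair z x} ind (pair-∈ {P = member T} z∈T x∈T) y∈T))

    -- After interchanging the sums, each of the s (q + 1) nonzero vectors of the line contributes
    -- the l lines through it.
    gram-row-sum : ∀ i → sum (gram i) ≡ s * (Q + 1ℤ) * l
    gram-row-sum i = begin
      sum (λ j → sum (λ x → incidence i x * incidence j x)) ≡⟨ ∑-comm (λ j x → incidence i x * incidence j x) ⟩
      sum (λ x → sum (λ j → incidence i x * incidence j x)) ≡⟨ sum-cong-≗ (λ x → trans
          (sym (*-distribˡ-sum (incidence i x) (λ j → incidence j x))) (column x (≈0? (vector x)))) ⟩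
      sum (λ x → incidence i x * l)                         ≡⟨ *-distribʳ-sum l (incidence i) ⟨
      sum (incidence i) * l                                 ≡⟨ cong (_* l) (incidence-row-sum i) ⟩
      s * (Q + 1ℤ) * l                                      ∎
      where
      column : ∀ x → Dec (vector x ≈ᴹ 0ᴹ) → incidence i x * sum (λ j → incidence j x) ≡ incidence i x * l
      column x (yes x≈0) = trans (cong (_* _) (incidence-zero i x≈0)) (sym (cong (_* l) (incidence-zero i x≈0)))
      column x (no x≉0)  = cong (incidence i x *_) (incidence-column-sum x≉0)

    -- Proportional vectors lie on the same l lines, independent ones on a single common line. These
    -- are the entries of Nᵀ N.
    common-lines : ∀ {x y} → ¬ (vector x ≈ᴹ 0ᴹ) → ¬ (vector y ≈ᴹ 0ᴹ) →
                   sum (λ j → incidence j x * incidence j y) ≡ 1ℤ + (l - 1ℤ) * multiple x y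
    common-lines {x} {y} x≉0 y≉0 = trans
      (sum-cong-≗ (λ j → cong₂ _*_ (incidence-nonzero j x≉0) (incidence-nonzero j y≉0)))
      (by-cases (span? (point (vector x)) (vector y)))
      where
      simplify₁ : ∀ l → 1ℤ + (l - 1ℤ) * 1ℤ ≡ l
      simplify₁ = solve-∀
      simplify₂ : ∀ l → 1ℤ + (l - 1ℤ) * 0ℤ ≡ 1ℤ
      simplify₂ = solve-∀
      by-cases : (d : Dec (vector y ∈ Span (point (vector x)))) →
                 sum (λ j → contains j x * contains j y) ≡ 1ℤ + (l - 1ℤ) * 𝟙 d
      by-cases (no y∉x)  = trans (lines-through-pair x≉0 y∉x) (sym (simplify₂ l))
      by-cases (yes y∈x) = trans (sum-cong-≗ (λ j → trans
          (cong (contains j x *_) (𝟙-⇔ (member? (vertex j) (vector y)) (member? (vertex j) (vector x))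
            (λ y∈j → span⊆ (isSubspace (vertex j)) (λ _ → y∈j) (∈-point-sym y≉0 y∈x))
            (λ x∈j → span⊆ (isSubspace (vertex j)) (λ _ → x∈j) y∈x)))
          (𝟙-idem (member? (vertex j) (vector x)))))
        (trans (lines-through x≉0) (sym (simplify₁ l)))

    -- The s nonzero multiples of x lie on the line k all together or not at all. With M for
    -- `multiple`, this is M Nᵀ = s Nᵀ on the rows of nonzero vectors.
    count-multiples-on-line : ∀ {x} k → ¬ (vector x ≈ᴹ 0ᴹ) → sum (λ y → multiple x y * incidence k y) ≡ s * incidence k x
    count-multiples-on-line {x} k x≉0 = trans
      (sum-cong-≗ (λ y → sym (𝟙-× (span? (point (vector x)) (vector y)) (nonzeroMember? k y))))
      (trans (by-cases (member? (vertex k) (vector x))) (cong (s *_) (sym (incidence-nonzero k x≉0))))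
      where
      D? : ∀ y → Dec _
      D? y = span? (point (vector x)) (vector y) ×-dec nonzeroMember? k y
      by-cases : (d : Dec (vector x ∈ member (vertex k))) → sum (λ y → 𝟙 (D? y)) ≡ s * 𝟙 d
      by-cases (no x∉k)  = trans (sum-cong-≗ (λ y → 𝟙-no (D? y) (λ (y∈x , y∈k , y≉0) →
          x∉k (span⊆ (isSubspace (vertex k)) (λ _ → y∈k) (∈-point-sym y≉0 y∈x)))))
        (trans (sum-replicate-zero (q ^ n)) (sym (ℤ.*-zeroʳ s)))
      by-cases (yes x∈k) = trans (sum-cong-≗ (λ y → 𝟙-⇔ (D? y)
          (span? (point (vector x)) (vector y) ×-dec ¬? (≈0? (vector y)))
          (λ (y∈x , _ , y≉0) → y∈x , y≉0)
          (λ (y∈x , y≉0) → y∈x , span⊆ (isSubspace (vertex k)) (λ _ → x∈k) y∈x , y≉0)))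
        (trans (count-nonzero (span? (point (vector x))) (span-isSubspace (point (vector x))) (point-basis x≉0))
        (trans (cong (_- 1ℤ) pos-q¹) (sym (ℤ.*-identityʳ s))))

    -- Regroup (N Nᵀ)² as N (Nᵀ N) Nᵀ. On nonzero vectors Nᵀ N = J + (l - 1) M, where M is
    -- `multiple`; then N J Nᵀ has all entries (s (q + 1))², and M Nᵀ = s Nᵀ turns the other term
    -- into (l - 1) s N Nᵀ.
    gram-square : ∀ i k → sum (λ j → gram i j * gram j k) ≡ (s * (Q + 1ℤ)) * (s * (Q + 1ℤ)) + (l - 1ℤ) * (s * gram i k)
    gram-square i k = begin
      sum (λ j → gram i j * gram j k)
        ≡⟨ sum-cong-≗ (λ j → sum-*-sum (λ x → incidence i x * incidence j x) (λ y → incidence j y * incidence k y)) ⟩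
      sum (λ j → sum (λ x → sum (λ y → (incidence i x * incidence j x) * (incidence j y * incidence k y))))
        ≡⟨ ∑-comm (λ j x → sum (λ y → (incidence i x * incidence j x) * (incidence j y * incidence k y))) ⟩
      sum (λ x → sum (λ j → sum (λ y → (incidence i x * incidence j x) * (incidence j y * incidence k y))))
        ≡⟨ sum-cong-≗ (λ x → trans
             (∑-comm (λ j y → (incidence i x * incidence j x) * (incidence j y * incidence k y)))
             (sum-cong-≗ (λ y → trans
               (sum-cong-≗ (λ j → swap (incidence i x) (incidence j x) (incidence j y) (incidence k y)))
               (trans (sym (*-distribˡ-sum (incidence i x * incidence k y) (λ j → incidence j x * incidence j y)))
                      (common x y (≈0? (vector x)) (≈0? (vector y))))))) ⟩
      sum (λ x → sum (λ y → incidence i x * incidence k y + c′ * (incidence i x * (multiple x y * incidence k y))))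
        ≡⟨ sum-cong-≗ (λ x → trans
             (∑-distrib-+ (λ y → incidence i x * incidence k y) (λ y → c′ * (incidence i x * (multiple x y * incidence k y))))
             (cong (_+_ (sum (λ y → incidence i x * incidence k y))) (trans
               (sym (*-distribˡ-sum c′ (λ y → incidence i x * (multiple x y * incidence k y))))
               (cong (c′ *_) (trans
                 (sym (*-distribˡ-sum (incidence i x) (λ y → multiple x y * incidence k y)))
                 (proportional x (≈0? (vector x)))))))) ⟩
      sum (λ x → sum (λ y → incidence i x * incidence k y) + c′ * (s * (incidence i x * incidence k x)))
        ≡⟨ ∑-distrib-+ (λ x → sum (λ y → incidence i x * incidence k y)) (λ x → c′ * (s * (incidence i x * incidence k x))) ⟩
      sum (λ x → sum (λ y → incidence i x * incidence k y)) + sum (λ x → c′ * (s * (incidence i x * incidence k x)))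
        ≡⟨ cong₂ _+_
             (trans (sym (sum-*-sum (incidence i) (incidence k))) (cong₂ _*_ (incidence-row-sum i) (incidence-row-sum k)))
             (trans (sym (*-distribˡ-sum c′ (λ x → s * (incidence i x * incidence k x))))
               (cong (c′ *_) (sym (*-distribˡ-sum s (λ x → incidence i x * incidence k x))))) ⟩
      (s * (Q + 1ℤ)) * (s * (Q + 1ℤ)) + c′ * (s * gram i k) ∎
      where
      c′ = l - 1ℤ
      swap : ∀ a b c d → (a * b) * (c * d) ≡ (a * d) * (b * c)
      swap = solve-∀
      expand : ∀ a b c e → (a * b) * (1ℤ + c * e) ≡ a * b + c * (a * (e * b))
      expand = solve-∀
      zeroˡ : ∀ b s c e → (0ℤ * b) * s ≡ 0ℤ * b + c * (0ℤ * (e * b))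
      zeroˡ = solve-∀
      zeroʳ : ∀ a s c e → (a * 0ℤ) * s ≡ a * 0ℤ + c * (a * (e * 0ℤ))
      zeroʳ = solve-∀
      move : ∀ a s b → a * (s * b) ≡ s * (a * b)
      move = solve-∀
      zero-move : ∀ t s b → 0ℤ * t ≡ s * (0ℤ * b)
      zero-move = solve-∀

      common : ∀ x y → Dec (vector x ≈ᴹ 0ᴹ) → Dec (vector y ≈ᴹ 0ᴹ) →
               (incidence i x * incidence k y) * sum (λ j → incidence j x * incidence j y) ≡
               incidence i x * incidence k y + c′ * (incidence i x * (multiple x y * incidence k y))
      -- `common-lines` says nothing about zero vectors, but there a factor `incidence` vanishes on
      -- both sides.
      common x y (yes x≈0) _ = subst
        (λ a → (a * incidence k y) * sum (λ j → incidence j x * incidence j y) ≡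
               a * incidence k y + c′ * (a * (multiple x y * incidence k y)))
        (sym (incidence-zero i x≈0)) (zeroˡ (incidence k y) (sum (λ j → incidence j x * incidence j y)) c′ (multiple x y))
      common x y (no _) (yes y≈0) = subst
        (λ b → (incidence i x * b) * sum (λ j → incidence j x * incidence j y) ≡
               incidence i x * b + c′ * (incidence i x * (multiple x y * b)))
        (sym (incidence-zero k y≈0)) (zeroʳ (incidence i x) (sum (λ j → incidence j x * incidence j y)) c′ (multiple x y))
      common x y (no x≉0) (no y≉0) = trans
        (cong ((incidence i x * incidence k y) *_) (common-lines x≉0 y≉0))
        (expand (incidence i x) (incidence k y) c′ (multiple x y))

      proportional : ∀ x → Dec (vector x ≈ᴹ 0ᴹ) →
                     incidence i x * sum (λ y → multiple x y * incidence k y) ≡ s * (incidence i x * incidence k x)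
      proportional x (yes x≈0) = subst
        (λ a → a * sum (λ y → multiple x y * incidence k y) ≡ s * (a * incidence k x))
        (sym (incidence-zero i x≈0)) (zero-move (sum (λ y → multiple x y * incidence k y)) s (incidence k x))
      proportional x (no x≉0) = trans (cong (incidence i x *_) (count-multiples-on-line k x≉0))
        (move (incidence i x) s (incidence k x))

    -- Relations for the adjacency matrix

    adjacency-symmetric : ∀ i j → adjacencyMatrix i j ≡ adjacencyMatrix j i
    adjacency-symmetric i j = 𝟙-⇔ (vertex i ~? vertex j) (vertex j ~? vertex i)
      (~-sym {vertex i} {vertex j}) (~-sym {vertex j} {vertex i})

    -- Row sums of N Nᵀ = s (A + w I) are s w l; removing the diagonal term s w and cancelling s
    -- leaves w (l - 1).
    adjacency-row-sum : ∀ i → sum (adjacencyMatrix i) ≡ (Q + 1ℤ) * (l - 1ℤ)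
    adjacency-row-sum i = ℤ.*-cancelˡ-≡ s _ _ (begin
      s * sum (adjacencyMatrix i)
        ≡⟨ add-sub (s * sum (adjacencyMatrix i)) r ⟩
      (s * sum (adjacencyMatrix i) + r * 1ℤ) - r
        ≡⟨ cong (_- r) (cong₂ _+_ (*-distribˡ-sum s (adjacencyMatrix i))
             (trans (cong (r *_) (sym one)) (*-distribˡ-sum r (δ i)))) ⟩
      (sum (λ j → s * adjacencyMatrix i j) + sum (λ j → r * δ i j)) - r
        ≡⟨ cong (_- r) (∑-distrib-+ (λ j → s * adjacencyMatrix i j) (λ j → r * δ i j)) ⟨
      sum (λ j → s * adjacencyMatrix i j + r * δ i j) - r
        ≡⟨ cong (_- r) (trans (sum-cong-≗ (λ j → sym (gram-adjacency i j))) (gram-row-sum i)) ⟩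
      s * (Q + 1ℤ) * l - r
        ≡⟨ factor s Q l ⟩
      s * ((Q + 1ℤ) * (l - 1ℤ)) ∎)
      where
      r = s * (Q + 1ℤ)
      one : sum (δ i) ≡ 1ℤ
      one = count-unique (i Fin.≟_) i refl (λ _ → sym)
      add-sub : ∀ a r → a ≡ (a + r * 1ℤ) - r
      add-sub = solve-∀
      factor : ∀ s q l → s * (q + 1ℤ) * l - s * (q + 1ℤ) ≡ s * ((q + 1ℤ) * (l - 1ℤ))
      factor = solve-∀

    -- Put G = s (A + w I) into G² = (s w)² J + c s G, where c = l - 1, and cancel s² to get (A + w
    -- I)² = w² J + c (A + w I).
    adjacency-quadratic : ∀ i k → sum (λ j → adjacencyMatrix i j * adjacencyMatrix j k) +
      ((+ 2) * (Q + 1ℤ) - (l - 1ℤ)) * adjacencyMatrix i k + (Q + 1ℤ) * (Q + 1ℤ - (l - 1ℤ)) * δ i k ≡ (Q + 1ℤ) * (Q + 1ℤ)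
    adjacency-quadratic i k = ℤ.*-cancelˡ-≡ s _ _ (ℤ.*-cancelˡ-≡ s _ _
      (isolate s (Q + 1ℤ) (l - 1ℤ) A² (adjacencyMatrix i k) (δ i k) (gram i k)
        (gram-adjacency i k) (trans (sym gram²) (gram-square i k))))
      where
      w = Q + 1ℤ
      A² = sum (λ j → adjacencyMatrix i j * adjacencyMatrix j k)
      rearrange : ∀ s w c a² a d → s * (s * (a² + ((+ 2) * w - c) * a + w * (w - c) * d)) ≡
        s * s * (a² + w * a + w * a + w * w * d) - c * (s * (s * a + (s * w) * d))
      rearrange = solve-∀
      finish : ∀ s w c g → (s * w) * (s * w) + c * (s * g) - c * (s * g) ≡ s * (s * (w * w))
      finish = solve-∀
      isolate : ∀ s w c a² a d g → g ≡ s * a + (s * w) * d →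
        s * s * (a² + w * a + w * a + w * w * d) ≡ (s * w) * (s * w) + c * (s * g) →
        s * (s * (a² + ((+ 2) * w - c) * a + w * (w - c) * d)) ≡ s * (s * (w * w))
      isolate s w c a² a d g refl h = trans (rearrange s w c a² a d) (trans
        (cong (_- c * (s * (s * a + (s * w) * d))) h)
        (finish s w c (s * a + (s * w) * d)))

      gram² : sum (λ j → gram i j * gram j k) ≡
              s * s * (A² + w * adjacencyMatrix i k + w * adjacencyMatrix i k + w * w * δ i k)
      gram² = begin
        sum (λ j → gram i j * gram j k)
          ≡⟨ sum-cong-≗ (λ j → trans (cong₂ _*_ (gram-adjacency i j) (gram-adjacency j k))
               (expand s w (adjacencyMatrix i j) (δ i j) (adjacencyMatrix j k) (δ j k))) ⟩
        sum (λ j → s * s * (f₁ j + w * f₂ j + w * f₃ j + w * w * f₄ j))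
          ≡⟨ *-distribˡ-sum (s * s) (λ j → f₁ j + w * f₂ j + w * f₃ j + w * w * f₄ j) ⟨
        s * s * sum (λ j → f₁ j + w * f₂ j + w * f₃ j + w * w * f₄ j)
          ≡⟨ cong (s * s *_) (split₃ (split₂ (split₁ refl f₂-sum) f₃-sum) f₄-sum) ⟩
        s * s * (A² + w * adjacencyMatrix i k + w * adjacencyMatrix i k + w * w * δ i k) ∎
        where
        f₁ f₂ f₃ f₄ : Fin order → ℤ
        f₁ j = adjacencyMatrix i j * adjacencyMatrix j k
        f₂ j = δ i j * adjacencyMatrix j k
        f₃ j = δ j k * adjacencyMatrix i j
        f₄ j = δ i j * δ j k

        expand : ∀ s w a d b e → (s * a + (s * w) * d) * (s * b + (s * w) * e) ≡
                 s * s * (a * b + w * (d * b) + w * (e * a) + w * w * (d * e))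
        expand = solve-∀

        add-scaled : ∀ c (f g : Fin order → ℤ) {u v} → sum f ≡ u → sum g ≡ v → sum (λ j → f j + c * g j) ≡ u + c * v
        add-scaled c f g refl refl = trans (∑-distrib-+ f (λ j → c * g j)) (cong (_+_ (sum f)) (sym (*-distribˡ-sum c g)))

        split₁ = add-scaled w f₁ f₂
        split₂ = add-scaled w (λ j → f₁ j + w * f₂ j) f₃
        split₃ = add-scaled (w * w) (λ j → f₁ j + w * f₂ j + w * f₃ j) f₄

        f₂-sum : sum f₂ ≡ adjacencyMatrix i k
        f₂-sum = sum-δ (λ j → adjacencyMatrix j k) i

        f₃-sum : sum f₃ ≡ adjacencyMatrix i k
        f₃-sum = trans
          (sum-cong-≗ (λ j → cong (_* adjacencyMatrix i j) (𝟙-⇔ (j Fin.≟ k) (k Fin.≟ j) sym sym)))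
          (sum-δ (adjacencyMatrix i) k)

        f₄-sum : sum f₄ ≡ δ i k
        f₄-sum = sum-δ (λ j → δ j k) i

    -- Double counting of incident pairs: every line has s (q + 1) nonzero vectors, and every
    -- nonzero vector lies on l lines.
    order-formula : + order * (Q + 1ℤ) * s ≡ (+ (q ^ n) - 1ℤ) * l
    order-formula = begin
      + order * (Q + 1ℤ) * s
        ≡⟨ regroup (+ order) s (Q + 1ℤ) ⟩
      + order * (s * (Q + 1ℤ))
        ≡⟨ trans (sum-cong-≗ incidence-row-sum) (sum-const order (s * (Q + 1ℤ))) ⟨
      sum (λ i → sum (incidence i))
        ≡⟨ ∑-comm incidence ⟩
      sum (λ x → sum (λ i → incidence i x))
        ≡⟨ sum-cong-≗ (λ x → column x (≈0? (vector x))) ⟩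
      sum (λ x → (1ℤ - 𝟙 (≈0? (vector x))) * l)
        ≡⟨ *-distribʳ-sum l (λ x → 1ℤ - 𝟙 (≈0? (vector x))) ⟨
      sum (λ x → 1ℤ - 𝟙 (≈0? (vector x))) * l
        ≡⟨ cong (_* l) (trans (sum-sub (λ _ → 1ℤ) (λ x → 𝟙 (≈0? (vector x)))) (cong₂ _-_
             (trans (sum-const (q ^ n) 1ℤ) (ℤ.*-identityʳ (+ (q ^ n))))
             (trans (sum-cong-≗ (λ x → 𝟙-⇔ (≈0? (vector x)) (vector x ≟ᴹ 0ᴹ) id id)) (count-vector 0ᴹ)))) ⟩
      (+ (q ^ n) - 1ℤ) * l ∎
      where
      regroup : ∀ o s w → o * w * s ≡ o * (s * w)
      regroup = solve-∀
      column : ∀ x (d : Dec (vector x ≈ᴹ 0ᴹ)) → sum (λ i → incidence i x) ≡ (1ℤ - 𝟙 d) * l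
      column x (yes x≈0) = trans (sum-cong-≗ (λ i → incidence-zero i x≈0)) (sum-replicate-zero order)
      column x (no x≉0)  = trans (incidence-column-sum x≉0) (sym (ℤ.*-identityˡ l))

-- The parameters of the Grassmann graph modulo p

mainTheorem3 :
  ∀ {c ℓ₁ ℓ₂ m ℓm : Level} (p t n : ℕ) → Prime p → 1 ≤ t → 4 ≤ n →
  (F : HeytingField c ℓ₁ ℓ₂)
  (F-card : HasCardinality (CommutativeRing.setoid (fieldRing F)) (p ^ t)) →
  (V : VectorSpace F m ℓm)
  (V-dim : LinearAlgebra.HasDimension F V U n) →
  let S = smithGroup (grassmannGraph F V F-card V-dim)
      open Subgroups (AbelianGroup.group S) in
  (∃[ P ] IsSylow {0ℓ} p P) ×
  ((P : Pred (AbelianGroup.Carrier S) 0ℓ) → IsSylow p P → IsCyclic P × HasOrder P (p ^ t))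
mainTheorem3 p (suc t) n@(suc (suc (suc k))) isPrime _ (ℕ.s≤s (ℕ.s≤s (ℕ.s≤s _))) F F-card V V-dim =
  (Torsion adjacencyMatrix p , torsion-isSylow adjacencyMatrix p) ,
  (λ P sylow → sylow-isCyclic sylow , sylow-hasOrder sylow)
  where
  instance
    p≢0 : ℕ.NonZero p
    p≢0 = prime⇒nonZero isPrime

  q : ℕ
  q = p ^ suc t

  Q r g l : ℤ
  Q = + q
  r = + (p ^ t)
  -- Since `n` is 3 + k, the q-integer l of n - 1 unfolds to 1 + Q (1 + Q g), so Q visibly divides l
  -- - 1.
  g = geometric Q k
  l = geometric Q (2 ℕ.+ k)

  Q≡ : Q ≡ + p * r
  Q≡ = ℤ.pos-* p (p ^ t)

  2≤q : 2 ≤ q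
  2≤q = ℕ.≤-trans (ℕ.nonTrivial⇒n>1 p {{prime⇒nonTrivial isPrime}}) (ℕ.m≤m*n p (p ^ t) {{ℕ.m^n≢0 p t}})

  qⁿ≡ : + (q ^ n) ≡ Q + (Q - 1ℤ) * Q * l
  qⁿ≡ = trans (pow-geometric q n) (regroup Q l)
    where
    regroup : ∀ q l → 1ℤ + (q - 1ℤ) * (1ℤ + q * l) ≡ q + (q - 1ℤ) * q * l
    regroup = solve-∀

  open FiniteGraph (grassmannGraph F V F-card V-dim) using (order; adjacencyMatrix)
  open Counting F V F-card V-dim
  open Incidence 2≤q l qⁿ≡

  instance
    Q-1≢0 : NonZero (Q - 1ℤ)
    Q-1≢0 = nonZero-pred 2≤q

  u D γ : ℤ
  -- This is the degree (Q + 1) (l - 1) divided by Q.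
  u = (Q + 1ℤ) * (1ℤ + Q * g)
  D = (Q + 1ℤ) * (Q + 1ℤ - (l - 1ℤ))
  γ = (+ 2) * (Q + 1ℤ) - (l - 1ℤ)

  -- The exponent is `suc t`, so p divides Q and a congruence modulo Q is enough.
  1+Q* : ∀ {a} d → a ≡ 1ℤ + Q * d → a ≡1[mod p ]
  1+Q* d refl = mk (r * d) (cong (_+_ 1ℤ) (trans (cong (_* d) Q≡) (ℤ.*-assoc (+ p) r d)))

  degree : ∀ i → sum (adjacencyMatrix i) ≡ Q * u
  degree i = trans (adjacency-row-sum i) (regroup Q g)
    where
    regroup : ∀ q g → (q + 1ℤ) * (1ℤ + q * (1ℤ + q * g) - 1ℤ) ≡ q * ((q + 1ℤ) * (1ℤ + q * g))
    regroup = solve-∀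

  u≡1 : u ≡1[mod p ]
  u≡1 = 1+Q* (1ℤ + g + Q * g) (expand Q g)
    where
    expand : ∀ q g → (q + 1ℤ) * (1ℤ + q * g) ≡ 1ℤ + q * (1ℤ + g + q * g)
    expand = solve-∀

  D≡1 : D ≡1[mod p ]
  D≡1 = 1+Q* (1ℤ - (g + Q * g) * Q) (expand Q g)
    where
    expand : ∀ q g → (q + 1ℤ) * (q + 1ℤ - (1ℤ + q * (1ℤ + q * g) - 1ℤ)) ≡ 1ℤ + q * (1ℤ - (g + q * g) * q)
    expand = solve-∀

  -- As q^n - 1 = (Q - 1) (1 + Q l), cancelling Q - 1 in `order-formula` gives o (Q + 1) = (1 + Q l)
  -- l for the order o. Division by Q + 1 is avoided through o = o (Q + 1) - Q o, so the quotient in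
  -- the congruence mentions o itself.
  order≡1 : + order ≡1[mod p ]
  order≡1 = 1+Q* _ (solveOrder (+ order) Q l (1ℤ + Q * g) refl (ℤ.*-cancelʳ-≡ _ _ (Q - 1ℤ)
    (trans order-formula (trans (cong (λ e → (e - 1ℤ) * l) (pow-geometric q n)) (regroup Q l)))))
    where
    regroup : ∀ q l → (1ℤ + (q - 1ℤ) * (1ℤ + q * l) - 1ℤ) * l ≡ ((1ℤ + q * l) * l) * (q - 1ℤ)
    regroup = solve-∀
    isolate : ∀ o q → o ≡ o * (q + 1ℤ) - q * o
    isolate = solve-∀
    expand : ∀ o q h → (1ℤ + q * (1ℤ + q * h)) * (1ℤ + q * h) - q * o ≡ 1ℤ + q * ((1ℤ + q * h) * (1ℤ + q * h) + h - o)
    expand = solve-∀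
    solveOrder : ∀ o q l h → l ≡ 1ℤ + q * h → o * (q + 1ℤ) ≡ (1ℤ + q * l) * l →
                 o ≡ 1ℤ + q * ((1ℤ + q * h) * (1ℤ + q * h) + h - o)
    solveOrder o q l h refl eq = trans (isolate o q) (trans (cong (_- q * o) eq) (expand o q h))

  open QuadraticCokernel adjacencyMatrix {p} {suc t} {u} {D} {γ} {(Q + 1ℤ) * (Q + 1ℤ)} degree
    (λ j → trans (sum-cong-≗ (λ i → adjacency-symmetric i j)) (degree j))
    adjacency-quadratic u≡1 D≡1 order≡1
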